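{- Let $p,s,t$ be positive integers with $t(t-2)\le s\le t^2$ and $s+t-1\le p$. Then $$\varrho_p(p+s+t-1)\le \frac{s}{p}\left(1-\frac1t\right).$$
   Context: For a graph $G$, $\alpha_p(G)$ is the maximum size of a vertex set $U$ such that $G[U]$ contains no $K_p$. $\mathsf{RT}_p(n,K_q,m)$ is the maximum number of edges in an $n$-vertex $K_q$-free graph $G$ with $\alpha_p(G)\le m$, and $\varrho_p(q):=\lim_{\varepsilon\to0}\lim_{n\to\infty}\mathsf{RT}_p(n,K_q,\varepsilon n)/\binom n2$. -}

module Defs where

open import Data.Nat using (ℕ; zero; suc; _<ᵇ_)
open import Data.Bool using (Bool; true; false; _∧_; if_then_else_)
open import Data.Fin using (Fin; toℕ)
open import Data.Fin.Subset using (Subset; _∈_; ∣_∣)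
open import Data.List using (List; map; allFin)
open import Data.Nat.ListAction using (sum)
open import Data.Integer using (+_)
open import Data.Rational using (ℚ; 0ℚ; _/_; _*_; _≤_)
open import Data.Product using (Σ; _×_)
open import Function.Definitions using (Injective)
open import Relation.Binary.PropositionalEquality using (_≡_)
open import Relation.Nullary using (¬_)

record Graph (n : ℕ) : Set where
  field
    adj   : Fin n → Fin n → Bool
    sym   : ∀ i j → adj i j ≡ adj j i
    irrefl : ∀ i → adj i i ≡ false
open Graph public

edgeInd : ∀ {n} → Graph n → Fin n → Fin n → ℕ
edgeInd G i j = if (toℕ i <ᵇ toℕ j) ∧ adj G i j then 1 else 0

numEdges : ∀ {n} → Graph n → ℕ
numEdges {n} G = sum (map (λ i → sum (map (λ j → edgeInd G i j) (allFin n))) (allFin n))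

IsClique : ∀ {n} → Graph n → (k : ℕ) → (Fin k → Fin n) → Set
IsClique G k f = Injective _≡_ _≡_ f × (∀ a b → ¬ (a ≡ b) → adj G (f a) (f b) ≡ true)

KFree : ∀ {n} → Graph n → ℕ → Set
KFree {n} G q = ¬ (Σ (Fin q → Fin n) λ f → IsClique G q f)

KFreeIn : ∀ {n} → Graph n → ℕ → Subset n → Set
KFreeIn {n} G p U = ¬ (Σ (Fin p → Fin n) λ f → IsClique G p f × (∀ a → f a ∈ U))

-- ℕ → ℚ, and the fraction a/b (b ≥ 1 in all uses; 0 for b = 0).
ℕtoℚ : ℕ → ℚ
ℕtoℚ a = + a / 1

frac : ℕ → ℕ → ℚ
frac a zero = 0ℚ
frac a (suc b) = + a / suc b

αBound : ∀ {n} → Graph n → ℕ → ℚ → Set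
αBound {n} G p m = ∀ (U : Subset n) → KFreeIn G p U → ℕtoℚ ∣ U ∣ ≤ m

-- ϱ_p(q) ≤ c, unfolding the double limit
-- ϱ_p(q) = lim_{ε→0} lim_{n→∞} RT_p(n,K_q,εn)/binom(n,2):
-- for every δ > 0 there are ε > 0 and N such that for all n ≥ N, every
-- n-vertex K_q-free graph G with α_p(G) ≤ εn has e(G) ≤ (c+δ)·binom(n,2).
ϱ≤ : ℕ → ℕ → ℚ → Set
ϱ≤ p q c =
  ∀ (δ : ℚ) → Data.Rational.Positive δ →
  Σ ℚ λ ε → Data.Rational.Positive ε × Σ ℕ λ N →
  ∀ (n : ℕ) → N Data.Nat.≤ n → (G : Graph n) → KFree G q →
  αBound G p (ε * ℕtoℚ n) →
  ℕtoℚ (numEdges G) ≤ (c Data.Rational.+ δ) * frac (n Data.Nat.* (n Data.Nat.∸ 1)) 2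

{-# OPTIONS --safe #-}
-- Put m = s + t - 1, so that q = m + p. Say that sets C_1, ..., C_k of linear size are pairwise
-- dense if no pair of large subsets of two of them is sparse. Choosing vertices of k - 2 of the
-- sets one by one reduces to the last pair (A , B); if its density exceeds (m + 1 - k) / p, then some
-- m + 2 - k vertices of a K_p in A have linearly many common neighbours in B, where a further K_p
-- completes a K_q. Hence k <= m, and the density of each pair is at most (m + 1 - k) / p.
--
-- Now pass to a subgraph whose minimum degree is a bit above g n, where g = (s / p)(1 - 1 / t), and take k
-- maximal. For linearly many vertices u the densities from u to the C_i sum to more than g k. Let J be
-- the set of i for which this density is not negligible, the same J for linearly many u, and
-- j = |J|. If j = k, these u provide a further set C_{k+1}. If j < k, each such density
-- is at most (m - j) / p, since u together with the C_i, i in J, behaves like j + 1 pairwise dense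
-- sets. So the sum is at most j (m - j) / p <= (j + 1) g <= k g, a contradiction.
--
-- Dense pairs come from a density increment instead of the regularity lemma. Since the theorem is a
-- decidable inequality, existence of dense sets is only needed in continuation-passing style
-- with result ⊥, which allows classical case distinctions. Densities are integers over a common
-- denominator L.
module Submission where

open import Defs
open import Data.Nat using (ℕ; _+_; _*_; _∸_; _≤_)
open import Data.Rational using (1ℚ; _-_)
open import Data.Product using (_×_)

import Data.Nat.Properties
open import Algebra.Properties.Semiring.Sum Data.Nat.Properties.+-*-semiring using (sum; sum-cong-≗; ∑-distrib-+; ∑-comm; *-distribˡ-sum; sum-replicate-zero)
open import Data.Bool using (Bool; true; false; _∧_; not; if_then_else_; T)
open import Data.Bool.Properties using (T-≡; T?)
open import Data.Empty using (⊥; ⊥-elim)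
open import Data.Fin as Fin using (Fin; zero; suc; toℕ)
open import Data.Fin.Subset using (∣_∣)
import Data.Integer as ℤ
import Data.Integer.Properties as ℤP
open import Data.List using (List; []; _∷_; _++_; length; filterᵇ; map; take; lookup; tabulate; allFin)
open import Data.List.Properties using (length-filter; length-take; length-++; length-map; filter-complete; map-tabulate; length-tabulate)
import Data.List.Membership.Propositional as Mem
open import Data.List.Membership.Propositional.Properties using (∈-∃++; ∈-filter⁻; ∈-lookup)
open import Data.List.Relation.Binary.Permutation.Propositional using (_↭_; ↭⇒↭ₛ)
open import Data.List.Relation.Binary.Permutation.Propositional.Properties using (shift; All-resp-↭; ↭-length)
import Data.List.Relation.Binary.Permutation.Setoid.Properties as Perm
open import Data.List.Relation.Binary.Pointwise as Pointwise using (Pointwise; []; _∷_; Pointwise-length)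
open import Data.List.Relation.Unary.All as All using (All; []; _∷_)
import Data.List.Relation.Unary.All.Properties as AllP
open import Data.List.Relation.Unary.AllPairs as AllPairs using (AllPairs; []; _∷_)
import Data.List.Relation.Unary.AllPairs.Properties as AllPairsP
open import Data.List.Relation.Unary.Any using (here)
open import Data.Nat using (zero; suc; pred; _^_; _/_; _%_; _<_; _<ᵇ_; _≤?_; _≟_; z≤n; s≤s; >-nonZero)
open import Data.Nat.DivMod using (m/n*n≤m; m%n<n; m≡m%n+[m/n]*n)
import Data.Nat.ListAction as ListAction
open import Data.Nat.Properties hiding (_≟_; _≤?_)
open import Data.Nat.Tactic.RingSolver using (solve-∀)
open import Data.Product using (Σ; ∃; _,_; proj₁; proj₂)
import Data.Rational as ℚ
import Data.Rational.Properties as ℚP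
open import Data.Rational using (ℚ; mkℚ; toℚᵘ)
open import Data.Rational.Unnormalised as ℚᵘ using (ℚᵘ; mkℚᵘ; _≃_)
import Data.Rational.Unnormalised.Properties as ℚᵘP
open import Data.Sum using (inj₁; inj₂)
import Data.Vec as Vec
import Data.Vec.Properties as VecP
open import Function using (_∘_; case_of_; Equivalence)
open import Relation.Binary.PropositionalEquality hiding (sym)
import Relation.Binary.PropositionalEquality as ≡
open import Relation.Nullary using (¬_; yes; no; contradiction)
open import Relation.Nullary.Decidable using (⌊_⌋; decidable-stable)


-- Indicator sums over vertex sets.

ind : Bool → ℕ
ind b = if b then 1 else 0

ind-∧ : ∀ a b → ind (a ∧ b) ≡ ind a * ind b
ind-∧ true  b = ≡.sym (+-identityʳ (ind b))
ind-∧ false b = refl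

_≤ᵈ_ : ℕ → ℕ → Bool
a ≤ᵈ b = ⌊ a ≤? b ⌋

≤ᵈ-true : ∀ {a b} → (a ≤ᵈ b) ≡ true → a ≤ b
≤ᵈ-true {a} {b} eq with a ≤? b
... | yes a≤b = a≤b

≤ᵈ-false : ∀ {a b} → (a ≤ᵈ b) ≡ false → b < a
≤ᵈ-false {a} {b} eq with a ≤? b
... | no a≰b = ≰⇒> a≰b

≤ᵈ-≤ : ∀ {a b} → a ≤ b → (a ≤ᵈ b) ≡ true
≤ᵈ-≤ {a} {b} a≤b with a ≤? b
... | yes _   = refl
... | no  a≰b = contradiction a≤b a≰b

sum-mono : ∀ {n} {f g : Fin n → ℕ} → (∀ u → f u ≤ g u) → sum f ≤ sum g
sum-mono {zero}  h = z≤n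
sum-mono {suc n} h = +-mono-≤ (h zero) (sum-mono (h ∘ suc))

Sub : ℕ → Set
Sub n = Fin n → Bool

module _ {n : ℕ} where

  infix 4 _∈_ _⊆_
  infixl 6 _∩_ _∖_

  _∈_ : Fin n → Sub n → Set
  u ∈ X = X u ≡ true

  _⊆_ : Sub n → Sub n → Set
  X ⊆ Y = ∀ u → u ∈ X → u ∈ Y

  _∩_ _∖_ : Sub n → Sub n → Sub n
  (X ∩ Y) u = X u ∧ Y u
  (X ∖ Y) u = X u ∧ not (Y u)

  ⊆-refl : ∀ {X} → X ⊆ X
  ⊆-refl u u∈X = u∈X

  ⊆-trans : ∀ {X Y Z} → X ⊆ Y → Y ⊆ Z → X ⊆ Z
  ⊆-trans p q u u∈X = q u (p u u∈X)

  ∩-⊆ˡ : ∀ X Y → X ∩ Y ⊆ X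
  ∩-⊆ˡ X Y u eq with X u
  ... | true = refl

  ∩-⊆ʳ : ∀ X Y → X ∩ Y ⊆ Y
  ∩-⊆ʳ X Y u eq with X u
  ... | true = eq

  ∖-⊆ˡ : ∀ X Y → X ∖ Y ⊆ X
  ∖-⊆ˡ X Y u eq with X u
  ... | true = refl

  ∈-∖ʳ : ∀ X Y u → u ∈ X ∖ Y → Y u ≡ false
  ∈-∖ʳ X Y u eq with X u | Y u
  ... | true | false = refl

  ∈-∩ : ∀ X Y {u} → u ∈ X → u ∈ Y → u ∈ X ∩ Y
  ∈-∩ X Y p q rewrite p = q

  ∩-mono : ∀ {X Y} Z → X ⊆ Y → X ∩ Z ⊆ Y ∩ Z
  ∩-mono {X} {Y} Z X⊆Y u u∈ = ∈-∩ Y Z (X⊆Y u (∩-⊆ˡ X Z u u∈)) (∩-⊆ʳ X Z u u∈)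

  opaque
    sumOver : Sub n → (Fin n → ℕ) → ℕ
    sumOver X f = sum λ u → ind (X u) * f u

  size : Sub n → ℕ
  size X = sumOver X λ _ → 1

  opaque
    unfolding sumOver

    sumOver-mono : ∀ X {f g} → (∀ u → u ∈ X → f u ≤ g u) → sumOver X f ≤ sumOver X g
    sumOver-mono X {f} {g} h = sum-mono go
      where
      go : ∀ u → ind (X u) * f u ≤ ind (X u) * g u
      go u with X u | h u
      ... | true  | hu = *-monoʳ-≤ 1 (hu refl)
      ... | false | _  = z≤n

    sumOver-cong : ∀ X {f g} → (∀ u → f u ≡ g u) → sumOver X f ≡ sumOver X g
    sumOver-cong X h = sum-cong-≗ λ u → cong (ind (X u) *_) (h u)

    sumOver-+ : ∀ X f g → sumOver X (λ u → f u + g u) ≡ sumOver X f + sumOver X g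
    sumOver-+ X f g = trans (sum-cong-≗ λ u → *-distribˡ-+ (ind (X u)) (f u) (g u)) (∑-distrib-+ (λ u → ind (X u) * f u) (λ u → ind (X u) * g u))

    sumOver-* : ∀ c X f → sumOver X (λ u → c * f u) ≡ c * sumOver X f
    sumOver-* c X f = trans (sum-cong-≗ λ u → x*cy≡c*xy (ind (X u)) c (f u)) (≡.sym (*-distribˡ-sum c (λ u → ind (X u) * f u)))
      where
      x*cy≡c*xy : ∀ x c y → x * (c * y) ≡ c * (x * y)
      x*cy≡c*xy = solve-∀

  sumOver-const : ∀ c X → sumOver X (λ _ → c) ≡ c * size X
  sumOver-const c X = trans (sumOver-cong X λ _ → ≡.sym (*-identityʳ c)) (sumOver-* c X λ _ → 1)

  opaque
    unfolding sumOver

    sumOver-split : ∀ X P f → sumOver X f ≡ sumOver (X ∩ P) f + sumOver (X ∖ P) f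
    sumOver-split X P f = trans (sum-cong-≗ go) (∑-distrib-+ (λ u → ind (X u ∧ P u) * f u) (λ u → ind (X u ∧ not (P u)) * f u))
      where
      go : ∀ u → ind (X u) * f u ≡ ind (X u ∧ P u) * f u + ind (X u ∧ not (P u)) * f u
      go u with X u | P u
      ... | false | _     = refl
      ... | true  | true  = ≡.sym (+-identityʳ (1 * f u))
      ... | true  | false = refl

  size-split : ∀ X P → size X ≡ size (X ∩ P) + size (X ∖ P)
  size-split X P = sumOver-split X P λ _ → 1

  opaque
    unfolding sumOver

    sumOver-⊆ : ∀ {X Y} → X ⊆ Y → ∀ f → sumOver X f ≤ sumOver Y f
    sumOver-⊆ {X} {Y} X⊆Y f = sum-mono go
      where
      go : ∀ u → ind (X u) * f u ≤ ind (Y u) * f u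
      go u with X u | X⊆Y u
      ... | false | _ = z≤n
      ... | true  | h rewrite h refl = ≤-refl

  size-⊆ : ∀ {X Y} → X ⊆ Y → size X ≤ size Y
  size-⊆ {X} {Y} X⊆Y = sumOver-⊆ {X} {Y} X⊆Y λ _ → 1

  opaque
    unfolding sumOver

    sumOver-swap : ∀ X Y (g : Fin n → Fin n → ℕ) →
      sumOver X (λ u → sumOver Y (g u)) ≡ sumOver Y (λ v → sumOver X (λ u → g u v))
    sumOver-swap X Y g = begin
      sum (λ u → ind (X u) * sum (λ v → ind (Y v) * g u v))
        ≡⟨ sum-cong-≗ (λ u → *-distribˡ-sum (ind (X u)) (λ v → ind (Y v) * g u v)) ⟩
      sum (λ u → sum (λ v → ind (X u) * (ind (Y v) * g u v)))
        ≡⟨ ∑-comm (λ u v → ind (X u) * (ind (Y v) * g u v)) ⟩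
      sum (λ v → sum (λ u → ind (X u) * (ind (Y v) * g u v)))
        ≡⟨ sum-cong-≗ (λ v → sum-cong-≗ λ u → exchange (ind (X u)) (ind (Y v)) (g u v)) ⟩
      sum (λ v → sum (λ u → ind (Y v) * (ind (X u) * g u v)))
        ≡⟨ sum-cong-≗ (λ v → *-distribˡ-sum (ind (Y v)) (λ u → ind (X u) * g u v)) ⟨
      sum (λ v → ind (Y v) * sum (λ u → ind (X u) * g u v)) ∎
      where
      open ≡-Reasoning
      exchange : ∀ x y z → x * (y * z) ≡ y * (x * z)
      exchange = solve-∀

    sumOver-∩ : ∀ X Y f → sumOver (X ∩ Y) f ≡ sumOver X (λ u → ind (Y u) * f u)
    sumOver-∩ X Y f = sum-cong-≗ λ u → trans (cong (_* f u) (ind-∧ (X u) (Y u))) (*-assoc (ind (X u)) (ind (Y u)) (f u))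

pick-sum : ∀ {n} (f : Fin n → ℕ) → 0 < sum f → ∃ λ u → 0 < f u
pick-sum {suc n} f 0<s with f zero in eq
... | suc k = zero , subst (0 <_) (≡.sym eq) (s≤s z≤n)
... | zero  = let u , p = pick-sum (f ∘ suc) 0<s in suc u , p

full : ∀ {n} → Sub n
full _ = true

-- Defined by recursion rather than from _≟_, so that sums over it compute.
single : ∀ {n} → Fin n → Sub n
single zero    zero    = true
single zero    (suc v) = false
single (suc u) zero    = false
single (suc u) (suc v) = single u v

single-≡ : ∀ {n} (u v : Fin n) → v ∈ single u → u ≡ v
single-≡ zero    zero    _ = refl
single-≡ (suc u) (suc v) h = cong suc (single-≡ u v h)

opaque
  unfolding sumOver

  size-full : ∀ n → size (full {n}) ≡ n
  size-full zero    = refl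
  size-full (suc n) = cong suc (size-full n)

  sumOver-full : ∀ {n} (f : Fin n → ℕ) → sumOver full f ≡ sum f
  sumOver-full f = sum-cong-≗ λ u → *-identityˡ (f u)

  sumOver-single : ∀ {n} (u : Fin n) f → sumOver (single u) f ≡ f u
  sumOver-single {suc n} zero    f = trans (cong (1 * f zero +_) (sum-replicate-zero n)) (trans (+-identityʳ _) (*-identityˡ (f zero)))
  sumOver-single {suc n} (suc u) f = sumOver-single u (f ∘ suc)

  member : ∀ {n} (X : Sub n) → 0 < size X → ∃ λ u → u ∈ X
  member X 0<X with pick-sum _ 0<X
  ... | u , 0<fu with X u in eq
  ... | true = u , eq

-- For every u the list filterᵇ (r u) xs is one of 2 ^ length xs sublists of xs.
pigeonhole : ∀ {n} {A : Set} (r : Fin n → A → Bool) xs (X : Sub n) →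
  Σ (List A) λ ys → Σ (Sub n) λ Y →
  Y ⊆ X × size X ≤ size Y * 2 ^ length xs × (∀ u → u ∈ Y → filterᵇ (r u) xs ≡ ys)
pigeonhole r []       X = [] , X , ⊆-refl , ≤-reflexive (≡.sym (*-identityʳ (size X))) , λ _ _ → refl
pigeonhole {n} r (x ∷ xs) X with pigeonhole r xs X
... | ys , Y , Y⊆X , X≤Y , same = choose (≤-total (size (Y ∖ P)) (size (Y ∩ P)))
  where
  P : Sub n
  P u = r u x
  half : ∀ a b → size Y ≡ a + b → b ≤ a → size X ≤ a * (2 * 2 ^ length xs)
  half a b eq b≤a = begin
    size X                    ≤⟨ X≤Y ⟩
    size Y * 2 ^ length xs    ≡⟨ cong (_* 2 ^ length xs) eq ⟩
    (a + b) * 2 ^ length xs   ≤⟨ *-monoˡ-≤ (2 ^ length xs) (+-monoʳ-≤ a b≤a) ⟩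
    (a + a) * 2 ^ length xs   ≡⟨ double a (2 ^ length xs) ⟩
    a * (2 * 2 ^ length xs)   ∎
    where
    open ≤-Reasoning
    double : ∀ a e → (a + a) * e ≡ a * (2 * e)
    double = solve-∀
  filter-true : ∀ u → u ∈ Y ∩ P → filterᵇ (r u) (x ∷ xs) ≡ x ∷ ys
  filter-true u u∈ with r u x | ∩-⊆ʳ Y P u u∈
  ... | true | _ = cong (x ∷_) (same u (∩-⊆ˡ Y P u u∈))
  filter-false : ∀ u → u ∈ Y ∖ P → filterᵇ (r u) (x ∷ xs) ≡ ys
  filter-false u u∈ with r u x | ∈-∖ʳ Y P u u∈
  ... | false | _ = same u (∖-⊆ˡ Y P u u∈)
  choose : _ → _
  choose (inj₁ le) = x ∷ ys , Y ∩ P , ⊆-trans (∩-⊆ˡ Y P) Y⊆X , half _ _ (size-split Y P) le , filter-true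
  choose (inj₂ le) = ys , Y ∖ P , ⊆-trans (∖-⊆ˡ Y P) Y⊆X , half _ _ (trans (size-split Y P) (+-comm (size (Y ∩ P)) _)) le , filter-false

-- Relative sizes of sets.

0<-factor : ∀ {a} x k → 0 < a → a ≤ x * k → 0 < x
0<-factor zero    k 0<a a≤ = ⊥-elim (<⇒≱ 0<a a≤)
0<-factor (suc x) k 0<a a≤ = s≤s z≤n

-- Relative sizes are recorded by their inverses: `a ≤ b * x` makes a set of size `b` at least an
-- `x`-th part of one of size `a`, so that successive losses multiply.
≤-chain : ∀ {a b} c x y → a ≤ b * x → b ≤ c * y → a ≤ c * (x * y)
≤-chain {a} {b} c x y p q = begin
  a            ≤⟨ p ⟩
  b * x        ≤⟨ *-monoˡ-≤ x q ⟩
  c * y * x    ≡⟨ assoc c y x ⟩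
  c * (x * y)  ∎
  where
  open ≤-Reasoning
  assoc : ∀ c y x → c * y * x ≡ c * (x * y)
  assoc = solve-∀

size-split-⊆ : ∀ {n} {X Y : Sub n} → Y ⊆ X → ∀ f → sumOver X f ≡ sumOver Y f + sumOver (X ∖ Y) f
size-split-⊆ {X = X} {Y} Y⊆X f = trans (sumOver-split X Y f) (cong (_+ sumOver (X ∖ Y) f)
  (≤-antisym (sumOver-⊆ (∩-⊆ʳ X Y) f) (sumOver-⊆ (λ u u∈Y → ∈-∩ X Y (Y⊆X u u∈Y) u∈Y) f)))

-- The loss in `increment`: a factor `L * K` in each of at most `suc (L * K)` rounds.
shrink : ℕ → ℕ → ℕ
shrink L K = (L * K) ^ suc (L * K)

-- Dense pairs and the density increment.

module Density {n : ℕ} (G : Graph n) where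

  N : Fin n → Sub n
  N = adj G

  deg : Fin n → Sub n → ℕ
  deg u Y = sumOver Y λ v → ind (N u v)

  deg≤size : ∀ u Y → deg u Y ≤ size Y
  deg≤size u Y = sumOver-mono Y λ v _ → ind≤1 (N u v)
    where
    ind≤1 : ∀ b → ind b ≤ 1
    ind≤1 true  = ≤-refl
    ind≤1 false = z≤n

  size-∩-N : ∀ u Y → size (Y ∩ N u) ≡ deg u Y
  size-∩-N u Y = trans (sumOver-∩ Y (N u) (λ _ → 1)) (sumOver-cong Y λ v → *-identityʳ (ind (N u v)))

  deg-swap : ∀ X Y → sumOver X (λ u → deg u Y) ≡ sumOver Y (λ v → deg v X)
  deg-swap X Y = trans (sumOver-swap X Y (λ u v → ind (N u v)))
    (sumOver-cong Y λ v → sumOver-cong X λ u → cong ind (sym G u v))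

  -- One-sided lower regularity: large subsets X of A and Y of B cannot have
  -- all degrees from X into Y below (b / L) |Y|; "large" means relative size at least 1 / K.
  record Dense (K b L : ℕ) (A B : Sub n) : Set where
    constructor dense
    field
      no-low : ∀ X Y → X ⊆ A → Y ⊆ B → size A ≤ size X * K → size B ≤ size Y * K →
        (∀ u → u ∈ X → L * deg u Y < b * size Y) → ⊥
  open Dense public

  Dense-mono : ∀ {K K' b L A B} → K' ≤ K → Dense K b L A B → Dense K' b L A B
  Dense-mono K'≤K d = dense λ X Y X⊆A Y⊆B A≤X B≤Y →
    no-low d X Y X⊆A Y⊆B (≤-trans A≤X (*-monoʳ-≤ (size X) K'≤K)) (≤-trans B≤Y (*-monoʳ-≤ (size Y) K'≤K))

  Dense-⊆ : ∀ {K b L A B A' B'} F → A' ⊆ A → B' ⊆ B → size A ≤ size A' * F → size B ≤ size B' * F →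
    Dense (K * F) b L A B → Dense K b L A' B'
  Dense-⊆ {K} F A'⊆A B'⊆B A≤ B≤ d = dense λ X Y X⊆A' Y⊆B' A'≤X B'≤Y →
    no-low d X Y (⊆-trans X⊆A' A'⊆A) (⊆-trans Y⊆B' B'⊆B) (large X A≤ A'≤X) (large Y B≤ B'≤Y)
    where
    large : ∀ {c c'} Z → c ≤ c' * F → c' ≤ size Z * K → c ≤ size Z * (K * F)
    large Z p q = ≤-trans (≤-chain (size Z) F K p q) (≤-reflexive (cong (size Z *_) (*-comm F K)))

  -- If (A , B) is not Dense, witnessed by (X , Y), then the degrees from X into B ∖ Y exceed
  -- the original ones by a fixed relative amount, which can only happen L * K times.
  increment : ∀ {K b L} → 1 ≤ K → 1 ≤ L → ∀ fuel a → L * K < fuel + a → b * K + K ≤ a →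
    ∀ A B → 0 < size A → 0 < size B → (∀ u → u ∈ A → a * size B ≤ L * K * deg u B) →
    (∀ A' B' → A' ⊆ A → B' ⊆ B → size A ≤ size A' * (L * K) ^ fuel → size B ≤ size B' * (L * K) ^ fuel →
      Dense K b L A' B' → ⊥) → ⊥
  increment {K} {b} {L} 1≤K 1≤L zero a full gap A B 0<A 0<B h cont with member A 0<A
  ... | u , u∈A = <-irrefl refl (begin-strict
    L * K * size B   <⟨ *-monoˡ-< (size B) {{>-nonZero 0<B}} full ⟩
    a * size B       ≤⟨ h u u∈A ⟩
    L * K * deg u B  ≤⟨ *-monoʳ-≤ (L * K) (deg≤size u B) ⟩
    L * K * size B   ∎)
    where open ≤-Reasoning
  increment {K} {b} {L} 1≤K 1≤L (suc fuel) a full gap A B 0<A 0<B h cont =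
    cont A B ⊆-refl ⊆-refl (self (size A)) (self (size B)) (dense step)
    where
    Λ : ℕ
    Λ = L * K
    K≤Λ : K ≤ Λ
    K≤Λ = subst (_≤ Λ) (*-identityˡ K) (*-monoˡ-≤ K 1≤L)
    self : ∀ x → x ≤ x * Λ ^ suc fuel
    self x = subst (_≤ x * Λ ^ suc fuel) (*-identityʳ x)
      (*-monoʳ-≤ x (m^n>0 Λ {{>-nonZero (≤-trans 1≤K K≤Λ)}} (suc fuel)))
    step : ∀ X Y → X ⊆ A → Y ⊆ B → size A ≤ size X * K → size B ≤ size Y * K →
      (∀ u → u ∈ X → L * deg u Y < b * size Y) → ⊥
    step X Y X⊆A Y⊆B A≤X B≤Y low =
      increment {b = b} 1≤K 1≤L fuel (suc a) (subst (Λ <_) (≡.sym (+-suc fuel a)) full) (m≤n⇒m≤1+n gap) X B' 0<X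
        (0<-factor (size B') Λ 0<B B≤ΛB') (λ u u∈X → suc-bound u u∈X)
        λ A″ B″ A″⊆X B″⊆B' X≤ B'≤ → cont A″ B″ (⊆-trans A″⊆X X⊆A) (⊆-trans B″⊆B' (∖-⊆ˡ B Y))
          (≤-chain (size A″) Λ (Λ ^ fuel) (≤-trans A≤X (*-monoʳ-≤ (size X) K≤Λ)) X≤)
          (≤-chain (size B″) Λ (Λ ^ fuel) B≤ΛB' B'≤)
      where
      open ≤-Reasoning
      B' : Sub n
      B' = B ∖ Y
      0<X : 0 < size X
      0<X = 0<-factor (size X) K 0<A A≤X
      -- Over the denominator `L * K`, `gap` puts the degree into `B` above what `low` allows into
      -- `Y` by `K * size Y`; the neighbours missing in `Y` must lie in `B'`.
      gain : ∀ u → u ∈ X → K * size Y + a * size B' ≤ Λ * deg u B'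
      gain u u∈X = +-cancelˡ-≤ (b * K * size Y) _ _ (begin
        b * K * size Y + (K * size Y + a * size B')  ≡⟨ regroup (b * K) K (size Y) (a * size B') ⟩
        (b * K + K) * size Y + a * size B'           ≤⟨ +-monoˡ-≤ (a * size B') (*-monoˡ-≤ (size Y) gap) ⟩
        a * size Y + a * size B'                     ≡⟨ *-distribˡ-+ a (size Y) (size B') ⟨
        a * (size Y + size B')                       ≡⟨ cong (a *_) (size-split-⊆ Y⊆B (λ _ → 1)) ⟨
        a * size B                                   ≤⟨ h u (X⊆A u u∈X) ⟩
        Λ * deg u B                                  ≡⟨ cong (Λ *_) (size-split-⊆ Y⊆B (λ v → ind (N u v))) ⟩
        Λ * (deg u Y + deg u B')                     ≡⟨ expand L K (deg u Y) (deg u B') ⟩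
        K * (L * deg u Y) + Λ * deg u B'             ≤⟨ +-monoˡ-≤ (Λ * deg u B') (*-monoʳ-≤ K (<⇒≤ (low u u∈X))) ⟩
        K * (b * size Y) + Λ * deg u B'              ≡⟨ cong (_+ Λ * deg u B') (rotate K b (size Y)) ⟩
        b * K * size Y + Λ * deg u B'                ∎)
        where
        regroup : ∀ x k y z → x * y + (k * y + z) ≡ (x + k) * y + z
        regroup = solve-∀
        expand : ∀ l k x y → l * k * (x + y) ≡ k * (l * x) + l * k * y
        expand = solve-∀
        rotate : ∀ k b y → k * (b * y) ≡ b * k * y
        rotate = solve-∀
      B≤KY : size B ≤ K * size Y
      B≤KY = subst (size B ≤_) (*-comm (size Y) K) B≤Y
      -- As `K * size Y` is at least `size B`, hence at least `size B'`, the surplus raises the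
      -- numerator `a` by a full unit.
      suc-bound : ∀ u → u ∈ X → suc a * size B' ≤ Λ * deg u B'
      suc-bound u u∈X = ≤-trans (+-monoˡ-≤ (a * size B') (≤-trans (size-⊆ (∖-⊆ˡ B Y)) B≤KY)) (gain u u∈X)
      -- The same surplus keeps `B'` large, since it consists of neighbours of one vertex inside
      -- `B'`.
      B≤ΛB' : size B ≤ size B' * Λ
      B≤ΛB' with member X 0<X
      ... | u , u∈X = begin
        size B                       ≤⟨ B≤KY ⟩
        K * size Y                   ≤⟨ m≤m+n _ _ ⟩
        K * size Y + a * size B'     ≤⟨ gain u u∈X ⟩
        Λ * deg u B'                 ≤⟨ *-monoʳ-≤ Λ (deg≤size u B') ⟩
        Λ * size B'                  ≡⟨ *-comm Λ (size B') ⟩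
        size B' * Λ                  ∎

  -- Over the denominator `L * K` the degrees start at `suc b * K`, exactly the `b * K + K` that
  -- `increment` asks for. One unit of `1 / L` is given up for regularity.
  densify : ∀ {K b L} → 1 ≤ K → 1 ≤ L → ∀ A B → 0 < size A → 0 < size B →
    (∀ u → u ∈ A → suc b * size B ≤ L * deg u B) →
    (∀ A' B' → A' ⊆ A → B' ⊆ B → size A ≤ size A' * shrink L K → size B ≤ size B' * shrink L K →
      Dense K b L A' B' → ⊥) → ⊥
  densify {K} {b} {L} 1≤K 1≤L A B 0<A 0<B h =
    increment {b = b} 1≤K 1≤L (suc (L * K)) (suc b * K) (s≤s (m≤m+n (L * K) (suc b * K)))
      (≤-reflexive (+-comm (b * K) K)) A B 0<A 0<B λ u u∈A → begin
        suc b * K * size B    ≡⟨ pull K (suc b) (size B) ⟩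
        K * (suc b * size B)  ≤⟨ *-monoʳ-≤ K (h u u∈A) ⟩
        K * (L * deg u B)     ≡⟨ pull' K L (deg u B) ⟩
        L * K * deg u B       ∎
    where
    open ≤-Reasoning
    pull : ∀ k b s → b * k * s ≡ k * (b * s)
    pull = solve-∀
    pull' : ∀ k l d → k * (l * d) ≡ l * k * d
    pull' = solve-∀

  -- Markov's inequality: if all of `Y` had density below `b / (2 * L)` into `X`, then counting
  -- edges from both sides would leave more than half of `X` with density below `b / L` into `Y`.
  -- That half contradicts the given density, hence the factors `2` on `K` and on `L`.
  Dense-flip : ∀ {K b L A B} → 1 ≤ K → 0 < size B → Dense (2 * K) b L A B → Dense K b (2 * L) B A
  Dense-flip {K} {b} {L} {A} {B} 1≤K 0<B d = dense step
    where
    step : ∀ Y X → Y ⊆ B → X ⊆ A → size B ≤ size Y * K → size A ≤ size X * K →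
      (∀ v → v ∈ Y → 2 * L * deg v X < b * size X) → ⊥
    step Y X Y⊆B X⊆A B≤Y A≤X low = no-low d Z Y (⊆-trans (∩-⊆ˡ X lowᵈ) X⊆A) Y⊆B
      (≤-trans A≤X (subst (size X * K ≤_) (*-assoc (size Z) 2 K) (*-monoˡ-≤ K X≤2Z)))
      (≤-trans B≤Y (*-monoʳ-≤ (size Y) (m≤m+n K (1 * K))))
      λ u u∈Z → ≤ᵈ-true (∩-⊆ʳ X lowᵈ u u∈Z)
      where
      open ≤-Reasoning
      lowᵈ : Sub n
      lowᵈ u = suc (L * deg u Y) ≤ᵈ (b * size Y)
      Z W : Sub n
      Z = X ∩ lowᵈ
      W = X ∖ lowᵈ
      0<Y : 0 < size Y
      0<Y = 0<-factor (size Y) K 0<B B≤Y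
      S : ℕ
      S = sumOver X λ u → deg u Y
      -- The extra `size Y` collects one unit from each strict inequality in `low`; it makes `2W<X`
      -- strict.
      upper : 2 * L * S + size Y ≤ b * size X * size Y
      upper = begin
        2 * L * S + size Y                                  ≡⟨ cong₂ _+_ (cong (2 * L *_) (deg-swap X Y)) (≡.sym (*-identityˡ (size Y))) ⟩
        2 * L * sumOver Y (λ v → deg v X) + 1 * size Y      ≡⟨ cong₂ _+_ (sumOver-* (2 * L) Y _) (sumOver-const 1 Y) ⟨
        sumOver Y (λ v → 2 * L * deg v X) + sumOver Y (λ _ → 1)    ≡⟨ sumOver-+ Y _ _ ⟨
        sumOver Y (λ v → 2 * L * deg v X + 1)               ≤⟨ sumOver-mono Y (λ v v∈Y → ≤-trans (≤-reflexive (+-comm _ 1)) (low v v∈Y)) ⟩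
        sumOver Y (λ _ → b * size X)                        ≡⟨ sumOver-const (b * size X) Y ⟩
        b * size X * size Y                                 ∎
      lower : b * size Y * size W ≤ L * S
      lower = begin
        b * size Y * size W                ≡⟨ sumOver-const (b * size Y) W ⟨
        sumOver W (λ _ → b * size Y)       ≤⟨ sumOver-mono W (λ u u∈W → ≤-pred (≤ᵈ-false (∈-∖ʳ X lowᵈ u u∈W))) ⟩
        sumOver W (λ u → L * deg u Y)      ≡⟨ sumOver-* L W _ ⟩
        L * sumOver W (λ u → deg u Y)      ≤⟨ *-monoʳ-≤ L (sumOver-⊆ (∖-⊆ˡ X lowᵈ) _) ⟩
        L * S                              ∎
      2W<X : 2 * size W < size X
      2W<X = *-cancelʳ-< (b * size Y) (2 * size W) (size X) (begin-strict
        2 * size W * (b * size Y)          ≡⟨ swap (size W) (b * size Y) ⟩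
        2 * (b * size Y * size W)          ≤⟨ *-monoʳ-≤ 2 lower ⟩
        2 * (L * S)                        ≡⟨ *-assoc 2 L S ⟨
        2 * L * S                          <⟨ m<m+n (2 * L * S) 0<Y ⟩
        2 * L * S + size Y                 ≤⟨ upper ⟩
        b * size X * size Y                ≡⟨ swap' b (size X) (size Y) ⟩
        size X * (b * size Y)              ∎)
        where
        swap : ∀ w y → 2 * w * y ≡ 2 * (y * w)
        swap = solve-∀
        swap' : ∀ b x y → b * x * y ≡ x * (b * y)
        swap' = solve-∀
      X≤2Z : size X ≤ size Z * 2
      X≤2Z = +-cancelʳ-≤ (2 * size W) _ _ (begin
        size X + 2 * size W        ≤⟨ +-monoʳ-≤ (size X) (<⇒≤ 2W<X) ⟩
        size X + size X            ≡⟨ cong (λ x → x + x) (size-split X lowᵈ) ⟩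
        (size Z + size W) + (size Z + size W)  ≡⟨ twice (size Z) (size W) ⟩
        size Z * 2 + 2 * size W    ∎)
        where
        twice : ∀ z w → (z + w) + (z + w) ≡ z * 2 + 2 * w
        twice = solve-∀

  -- Both directions are kept because `densify` uses degrees out of a new set, whereas `embed` picks
  -- vertices in an older one, and because clusters get reordered. The denominator `2 * L` is what
  -- `Dense-flip` leaves.
  Sym : (K L : ℕ) → Sub n → Sub n → Set
  Sym K L A B = Dense K 1 (2 * L) A B × Dense K 1 (2 * L) B A

  -- Of the two units of `1 / L`, one is spent in `densify` and the other is halved by the flip.
  densify-sym : ∀ {K L} → 1 ≤ K → 1 ≤ L → ∀ A B → 0 < size A → 0 < size B →
    (∀ u → u ∈ A → 2 * size B ≤ L * deg u B) →
    (∀ A' B' → A' ⊆ A → B' ⊆ B → size A ≤ size A' * shrink L (2 * K) → size B ≤ size B' * shrink L (2 * K) →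
      Sym K L A' B' → ⊥) → ⊥
  densify-sym {K} {L} 1≤K 1≤L A B 0<A 0<B h cont =
    densify {b = 1} (≤-trans 1≤K (m≤m+n K (1 * K))) 1≤L A B 0<A 0<B h λ A' B' A'⊆A B'⊆B A≤ B≤ d →
      cont A' B' A'⊆A B'⊆B A≤ B≤
        ( dense (λ X Y X⊆ Y⊆ A'≤ B'≤ low → no-low d X Y X⊆ Y⊆
             (≤-trans A'≤ (*-monoʳ-≤ (size X) (m≤m+n K (1 * K)))) (≤-trans B'≤ (*-monoʳ-≤ (size Y) (m≤m+n K (1 * K))))
             λ u u∈X → ≤-<-trans (*-monoˡ-≤ (deg u Y) (m≤m+n L (1 * L))) (low u u∈X))
        , Dense-flip 1≤K (0<-factor (size B') _ 0<B B≤) d)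

-- Embedding cliques into pairwise dense sets.

AllPairs-restrict : ∀ {A : Set} {P : A → Set} {R : A → A → Set} {xs} →
  All P xs → AllPairs R xs → AllPairs (λ x y → P x × P y × R x y) xs
AllPairs-restrict []         []         = []
AllPairs-restrict (px ∷ pxs) (rx ∷ rxs) =
  All.zipWith (λ (py , r) → px , py , r) (pxs , rx) ∷ AllPairs-restrict pxs rxs

filterᵇ-holds : ∀ {A : Set} {r : A → Bool} xs {ys} → filterᵇ r xs ≡ ys → All (λ u → r u ≡ true) ys
filterᵇ-holds {r = r} xs refl = All.map (Equivalence.to T-≡) (AllP.all-filter (T? ∘ r) xs)

module Embedding {n : ℕ} (G : Graph n) where
  open Density G

  Adj : Fin n → Fin n → Set
  Adj u v = N u v ≡ true

  CliqueFree : Sub n → ℕ → Set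
  CliqueFree S q = ∀ ws → length ws ≡ q → AllPairs Adj ws → All (_∈ S) ws → ⊥

  -- This is `α_p(G) ≤ n / E` in contrapositive form. The doubly negated clique suffices, as it is
  -- only ever used towards `⊥`.
  CliqueRich : ℕ → ℕ → Set
  CliqueRich p E = ∀ X → n < size X * E → ¬ CliqueFree X p

  CliqueRich-mono : ∀ {p E E'} → E' ≤ E → CliqueRich p E → CliqueRich p E'
  CliqueRich-mono E'≤E rich X n< = rich X (≤-trans n< (*-monoʳ-≤ (size X) E'≤E))

  -- The successor turns a non-strict size bound into the strict one of `CliqueRich`; this is the
  -- origin of `suc` in `pairE` and `baseE`.
  has-clique : ∀ {p} M {M'} X → 1 ≤ n → n ≤ size X * M → M ≤ M' → CliqueRich p (suc M') → ¬ CliqueFree X p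
  has-clique M {M'} X 1≤n n≤ M≤M' rich = rich X (begin-strict
    n                    ≤⟨ n≤ ⟩
    size X * M           ≤⟨ *-monoʳ-≤ (size X) M≤M' ⟩
    size X * M'          <⟨ m<n+m (size X * M') (0<-factor (size X) M 1≤n n≤) ⟩
    size X + size X * M' ≡⟨ *-suc (size X) M' ⟨
    size X * suc M'      ∎)
    where open ≤-Reasoning

  low : (b L : ℕ) → Sub n → Sub n
  low b L Y u = suc (L * deg u Y) ≤ᵈ (b * size Y)

  -- Otherwise the low vertices and the whole of `B` would form a pair that `no-low` forbids.
  few-low : ∀ {K b L A B} → 1 ≤ K → Dense K b L A B → ∀ {X} → X ⊆ A → size (X ∩ low b L B) * K < size A
  few-low {K} {b} {L} {A} {B} 1≤K d {X} X⊆A with size A ≤? size (X ∩ low b L B) * K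
  ... | no  ≰ = ≰⇒> ≰
  ... | yes A≤ = ⊥-elim (no-low d (X ∩ low b L B) B (⊆-trans (∩-⊆ˡ X (low b L B)) X⊆A) ⊆-refl A≤
    (m≤m*n (size B) K {{>-nonZero 1≤K}}) λ u u∈ → ≤ᵈ-true (∩-⊆ʳ X (low b L B) u u∈))

  not-low : ∀ b L X B u → u ∈ X ∖ low b L B → b * size B ≤ L * deg u B
  not-low b L X B u u∈ = ≤-pred (≤ᵈ-false (∈-∖ʳ X (low b L B) u u∈))

  -- By `few-low` each target spoils fewer than `size D / K` vertices, and `X` has more than
  -- `length Ts` times that many.
  pick : ∀ {K b L} D X Ts → X ⊆ D → size D * length Ts < size X * K → 1 ≤ K → All (Dense K b L D) Ts →
    ∃ λ v → v ∈ X × All (λ T → b * size T ≤ L * deg v T) Ts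
  pick {K} D X [] X⊆D h 1≤K [] =
    let v , v∈X = member X (0<-factor (size X) K (≤-trans (s≤s z≤n) h) ≤-refl) in v , v∈X , []
  pick {K} {b} {L} D X (T ∷ Ts) X⊆D h 1≤K (d ∷ ds) =
    let v , v∈W , vs = pick D W Ts (⊆-trans (∖-⊆ˡ X (low b L T)) X⊆D) bound 1≤K ds
    in v , ∖-⊆ˡ X (low b L T) v v∈W , not-low b L X T v v∈W ∷ vs
    where
    W : Sub n
    W = X ∖ low b L T
    bound : size D * length Ts < size W * K
    bound = +-cancelˡ-< (size D) _ _ (begin-strict
      size D + size D * length Ts              ≡⟨ *-suc (size D) (length Ts) ⟨
      size D * length (T ∷ Ts)                 <⟨ h ⟩
      size X * K                               ≡⟨ cong (_* K) (size-split X (low b L T)) ⟩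
      (size (X ∩ low b L T) + size W) * K      ≡⟨ *-distribʳ-+ K (size (X ∩ low b L T)) (size W) ⟩
      size (X ∩ low b L T) * K + size W * K    ≤⟨ +-monoˡ-≤ (size W * K) (<⇒≤ (few-low 1≤K d X⊆D)) ⟩
      size D + size W * K                      ∎)
      where open ≤-Reasoning

  count : Fin n → List (Fin n) → ℕ
  count v P = length (filterᵇ (N v) P)

  -- Double counting of the edges between `P` and `B`.
  sum-count : ∀ c L B P → All (λ u → c ≤ L * deg u B) P → length P * c ≤ L * sumOver B (λ v → count v P)
  sum-count c L B [] [] = z≤n
  sum-count c L B (u ∷ P) (h ∷ hs) = begin
    c + length P * c                                          ≤⟨ +-mono-≤ h (sum-count c L B P hs) ⟩
    L * deg u B + L * sumOver B (λ v → count v P)             ≡⟨ *-distribˡ-+ L (deg u B) _ ⟨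
    L * (deg u B + sumOver B (λ v → count v P))               ≡⟨ cong (L *_) (sumOver-+ B _ _) ⟨
    L * sumOver B (λ v → ind (N u v) + count v P)             ≡⟨ cong (L *_) (sumOver-cong B cons) ⟩
    L * sumOver B (λ v → count v (u ∷ P))                     ∎
    where
    open ≤-Reasoning
    cons : ∀ v → ind (N u v) + count v P ≡ count v (u ∷ P)
    cons v rewrite sym G u v with N v u
    ... | true  = refl
    ... | false = refl

  -- A copy P of K_p among the vertices of A with many neighbours in B; by averaging, a positive
  -- proportion of B sees the same s' + 1 vertices of P, and that part of B contains another K_p.
  pair-clique : ∀ {p s' Q L K Γ S} A B → L ≡ p * Q → 1 ≤ p → 1 ≤ n → 2 ≤ K → A ⊆ S → B ⊆ S →
    n ≤ size A * Γ → n ≤ size B * Γ → Dense K (suc (s' * Q)) L A B →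
    CliqueRich p (suc (Γ * (2 + L * 2 ^ p))) → ¬ CliqueFree S (suc s' + p)
  pair-clique {p} {s'} {Q} {L} {K} {Γ} {S} A B L≡ 1≤p 1≤n 2≤K A⊆S B⊆S n≤A n≤B d rich free =
    has-clique (Γ * 2) X 1≤n (≤-chain (size X) Γ 2 n≤A A≤2X) (*-monoʳ-≤ Γ (m≤m+n 2 _)) rich λ P |P| cP P⊆X →
    let open Common P |P| cP P⊆X in
    has-clique (Γ * (L * 2 ^ p)) Z 1≤n (≤-chain (size Z) Γ (L * 2 ^ p) n≤B B≤Z) (*-monoʳ-≤ Γ (m≤n+m _ 2)) rich
      λ R |R| cR R⊆Z → free (zs ++ R)
        (trans (length-++ zs) (cong₂ _+_ |zs| |R|))
        (AllPairsP.++⁺ (AllPairsP.take⁺ (suc s') clique-ys) cR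
          (All.tabulate λ {u} u∈zs → All.map (λ {v} v∈Z → trans (sym G u v) (All.lookup (sees v v∈Z) u∈zs)) R⊆Z))
        (AllP.++⁺ (All.map (λ {u} u∈X → A⊆S u (∖-⊆ˡ A (low b L B) u u∈X)) (AllP.take⁺ (suc s') ys⊆X))
          (All.map (λ {v} v∈Z → B⊆S v (Z⊆B v v∈Z)) R⊆Z))
    where
    b : ℕ
    b = suc (s' * Q)
    X : Sub n
    X = A ∖ low b L B
    A≤2X : size A ≤ size X * 2
    A≤2X = +-cancelˡ-≤ (bad * 2) _ _ (begin
      bad * 2 + size A                      ≤⟨ +-monoˡ-≤ (size A) (*-monoʳ-≤ bad 2≤K) ⟩
      bad * K + size A                      ≤⟨ +-monoˡ-≤ (size A) (<⇒≤ (few-low (≤-trans (s≤s z≤n) 2≤K) d {A} ⊆-refl)) ⟩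
      size A + size A                       ≡⟨ cong (λ a → a + a) (size-split A (low b L B)) ⟩
      (bad + size X) + (bad + size X)       ≡⟨ twice bad (size X) ⟩
      bad * 2 + size X * 2                  ∎)
      where
      open ≤-Reasoning
      bad : ℕ
      bad = size (A ∩ low b L B)
      twice : ∀ z w → (z + w) + (z + w) ≡ z * 2 + w * 2
      twice = solve-∀
    module Common (P : List (Fin n)) (|P| : length P ≡ p) (cP : AllPairs Adj P) (P⊆X : All (_∈ X) P) where
      open ≤-Reasoning
      many : Sub n
      many v = suc s' ≤ᵈ count v P
      Y : Sub n
      Y = B ∩ many
      -- A vertex of `Y` sees at most `p` vertices of `P`, any other vertex of `B` at most `s'`.
      -- Since `b` exceeds `s' * Q` by one, a term `size B` survives the cancellation in `B≤Y`.
      averaging : p * (b * size B) ≤ p * (Q * (p * size Y + s' * size B))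
      averaging = begin
        p * (b * size B)                                ≡⟨ cong (_* (b * size B)) |P| ⟨
        length P * (b * size B)                         ≤⟨ sum-count (b * size B) L B P (All.map (λ {u} → not-low b L A B u) P⊆X) ⟩
        L * sumOver B (λ v → count v P)                 ≡⟨ cong₂ _*_ L≡ (sumOver-split B many _) ⟩
        p * Q * (sumOver Y (λ v → count v P) + sumOver (B ∖ many) (λ v → count v P))
          ≤⟨ *-monoʳ-≤ (p * Q) (+-mono-≤
               (≤-trans (sumOver-mono Y λ v _ → ≤-trans (length-filter (T? ∘ N v) P) (≤-reflexive |P|)) (≤-reflexive (sumOver-const p Y)))
               (≤-trans (sumOver-mono (B ∖ many) λ v v∈ → ≤-pred (≤ᵈ-false (∈-∖ʳ B many v v∈)))
                 (≤-trans (≤-reflexive (sumOver-const s' (B ∖ many))) (*-monoʳ-≤ s' (size-⊆ (∖-⊆ˡ B many)))))) ⟩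
        p * Q * (p * size Y + s' * size B)              ≡⟨ *-assoc p Q _ ⟩
        p * (Q * (p * size Y + s' * size B))            ∎
      B≤Y : size B ≤ size Y * L
      B≤Y = +-cancelʳ-≤ (s' * Q * size B) _ _ (begin
        size B + s' * Q * size B                        ≤⟨ *-cancelˡ-≤ p {{>-nonZero 1≤p}} averaging ⟩
        Q * (p * size Y + s' * size B)                  ≡⟨ regroup Q p (size Y) s' (size B) ⟩
        size Y * (p * Q) + s' * Q * size B              ≡⟨ cong (λ l → size Y * l + s' * Q * size B) L≡ ⟨
        size Y * L + s' * Q * size B                    ∎)
        where
        regroup : ∀ q p y s b → q * (p * y + s * b) ≡ y * (p * q) + s * q * b
        regroup = solve-∀
      pig : Σ (List (Fin n)) λ ys → Σ (Sub n) λ Z →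
        Z ⊆ Y × size Y ≤ size Z * 2 ^ length P × (∀ u → u ∈ Z → filterᵇ (N u) P ≡ ys)
      pig = pigeonhole N P Y
      ys zs : List (Fin n)
      ys = proj₁ pig
      zs = take (suc s') ys
      Z : Sub n
      Z = proj₁ (proj₂ pig)
      Z⊆Y : Z ⊆ Y
      Z⊆Y = proj₁ (proj₂ (proj₂ pig))
      Z⊆B : Z ⊆ B
      Z⊆B = ⊆-trans Z⊆Y (∩-⊆ˡ B many)
      same : ∀ u → u ∈ Z → filterᵇ (N u) P ≡ ys
      same = proj₂ (proj₂ (proj₂ (proj₂ pig)))
      B≤Z : size B ≤ size Z * (L * 2 ^ p)
      B≤Z = ≤-chain (size Z) L (2 ^ p) B≤Y (subst (λ k → size Y ≤ size Z * 2 ^ k) |P| (proj₁ (proj₂ (proj₂ (proj₂ pig)))))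
      witness : ∃ λ v → v ∈ Z
      witness = member Z (0<-factor (size Z) _ (0<-factor (size B) Γ 1≤n n≤B) B≤Z)
      ys≡ : filterᵇ (N (proj₁ witness)) P ≡ ys
      ys≡ = same _ (proj₂ witness)
      |zs| : length zs ≡ suc s'
      |zs| = trans (length-take (suc s') ys) (m≤n⇒m⊓n≡m
        (subst (suc s' ≤_) (cong length ys≡) (≤ᵈ-true (∩-⊆ʳ B many _ (Z⊆Y _ (proj₂ witness))))))
      clique-ys : AllPairs Adj ys
      clique-ys = subst (AllPairs Adj) ys≡ (AllPairsP.filter⁺ (T? ∘ N (proj₁ witness)) cP)
      ys⊆X : All (_∈ X) ys
      ys⊆X = subst (All (_∈ X)) ys≡ (AllP.filter⁺ (T? ∘ N (proj₁ witness)) P⊆X)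
      sees : ∀ v → v ∈ Z → All (λ u → N v u ≡ true) zs
      sees v v∈Z = AllP.take⁺ (suc s') (filterᵇ-holds P (same v v∈Z))

  Cluster : Sub n → ℕ → Sub n → Set
  Cluster S Γ X = X ⊆ S × n ≤ size X * Γ

  CliqueFree-∩ : ∀ {S q v} → v ∈ S → CliqueFree S (suc q) → CliqueFree (S ∩ N v) q
  CliqueFree-∩ {S} {q} {v} v∈S free ws |ws| cws ws⊆ = free (v ∷ ws) (cong suc |ws|)
    (All.map (λ {u} → ∩-⊆ʳ S (N v) u) ws⊆ ∷ cws) (v∈S ∷ All.map (λ {u} → ∩-⊆ˡ S (N v) u) ws⊆)

  -- Induction on `r`: a vertex `v` of the first set `D`, typical for all other sets, joins the
  -- clique, and everything is cut down to its neighbourhood. Each set loses at most a factor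
  -- `2 * L`, which the powers in the hypotheses pay for, and inside `S ∩ N v` the forbidden clique
  -- is one smaller. The pair `(A , B)` is left for `pair-clique`.
  embed : ∀ {p s' Q L K Γ S} r Ds A B → length Ds ≡ r → L ≡ p * Q → 1 ≤ L → 1 ≤ p → 1 ≤ n → 2 + r ≤ K →
    All (Cluster S Γ) (A ∷ B ∷ Ds) →
    AllPairs (Dense (K * (2 * L) ^ r) 1 (2 * L)) Ds →
    All (λ D → Dense (K * (2 * L) ^ r) 1 (2 * L) D A × Dense (K * (2 * L) ^ r) 1 (2 * L) D B) Ds →
    Dense (K * (2 * L) ^ r) (suc (s' * Q)) L A B →
    CliqueRich p (suc (Γ * (2 * L) ^ r * (2 + L * 2 ^ p))) → ¬ CliqueFree S (r + (suc s' + p))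
  embed {p} {L = L} {K} {Γ} zero [] A B _ L≡ 1≤L 1≤p 1≤n len≤K ((A⊆S , n≤A) ∷ (B⊆S , n≤B) ∷ []) _ _ d rich =
    pair-clique A B L≡ 1≤p 1≤n len≤K A⊆S B⊆S n≤A n≤B (subst (λ k → Dense k _ L A B) (*-identityʳ K) d)
      (subst (λ g → CliqueRich p (suc (g * (2 + L * 2 ^ p)))) (*-identityʳ Γ) rich)
  embed {p} {s'} {Q} {L} {K} {Γ} {S} (suc r) (D ∷ Ds) A B len L≡ 1≤L 1≤p 1≤n len≤K (cA ∷ cB ∷ cD ∷ cDs)
    (dDs ∷ dd) ((dA , dB) ∷ dAB) d rich free =
    after (pick {K * F ^ suc r} D D (A ∷ B ∷ Ds) ⊆-refl (*-monoʳ-< (size D) {{>-nonZero 0<D}} len<K)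
      (≤-trans (s≤s z≤n) len<K) (dA ∷ dB ∷ dDs))
    where
    F : ℕ
    F = 2 * L
    |Ds| : length Ds ≡ r
    |Ds| = suc-injective len
    0<D : 0 < size D
    0<D = 0<-factor (size D) Γ 1≤n (proj₂ cD)
    1≤F : 1 ≤ F
    1≤F = ≤-trans 1≤L (m≤m+n L (1 * L))
    len<K : 2 + length Ds < K * F ^ suc r
    len<K = ≤-trans (subst (λ k → 3 + k ≤ K) (≡.sym |Ds|) len≤K)
      (m≤m*n K (F ^ suc r) {{>-nonZero (m^n>0 F {{>-nonZero 1≤F}} (suc r))}})
    Seen : Fin n → Sub n → Set
    Seen v X = 1 * size X ≤ F * deg v X
    shrunk : ∀ v X → Seen v X → size X ≤ size (X ∩ N v) * F
    shrunk v X h = subst₂ _≤_ (*-identityˡ (size X))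
      (trans (cong (F *_) (≡.sym (size-∩-N v X))) (*-comm F (size (X ∩ N v)))) h
    cut-cluster : ∀ v X → Cluster S Γ X → Seen v X → Cluster (S ∩ N v) (Γ * F) (X ∩ N v)
    cut-cluster v X (X⊆S , n≤) h = ∩-mono (N v) X⊆S , ≤-chain (size (X ∩ N v)) Γ F n≤ (shrunk v X h)
    cut-dense : ∀ {b L'} v X Y → Seen v X → Seen v Y → Dense (K * F ^ suc r) b L' X Y →
      Dense (K * F ^ r) b L' (X ∩ N v) (Y ∩ N v)
    cut-dense {b} {L'} v X Y hX hY d = Dense-⊆ F (∩-⊆ˡ X (N v)) (∩-⊆ˡ Y (N v)) (shrunk v X hX) (shrunk v Y hY)
      (subst (λ k → Dense k b L' X Y) (assoc K F (F ^ r)) d)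
      where
      assoc : ∀ k f e → k * (f * e) ≡ k * e * f
      assoc = solve-∀
    after : (∃ λ v → v ∈ D × All (Seen v) (A ∷ B ∷ Ds)) → ⊥
    after (v , v∈D , sees@(vA ∷ vB ∷ vDs)) =
      embed r (map (_∩ N v) Ds) (A ∩ N v) (B ∩ N v) (trans (length-map (_∩ N v) Ds) |Ds|) L≡ 1≤L 1≤p 1≤n (≤-trans (n≤1+n _) len≤K)
        (AllP.map⁺ (All.zipWith (λ {X} (a , b) → cut-cluster v X a b) (cA ∷ cB ∷ cDs , sees)))
        (AllPairsP.map⁺ (AllPairs.map (λ {X} {Y} (a , b , c) → cut-dense v X Y a b c) (AllPairs-restrict vDs dd)))
        (AllP.map⁺ (All.zipWith (λ {X} (a , (b , c)) → cut-dense v X A a vA b , cut-dense v X B a vB c) (vDs , dAB)))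
        (cut-dense v A B vA vB d)
        (subst (λ g → CliqueRich p (suc (g * (2 + L * 2 ^ p)))) (≡.sym (*-assoc Γ F (F ^ r))) rich)
        (CliqueFree-∩ (proj₁ cD v v∈D) free)

-- Making one set dense to several clusters.

All-Pointwise : ∀ {A B : Set} {P : A → Set} {R : A → B → Set} {P' : B → Set} {xs ys} →
  (∀ {x y} → P x → R x y → P' y) → All P xs → Pointwise R xs ys → All P' ys
All-Pointwise f []         []         = []
All-Pointwise f (px ∷ pxs) (r ∷ rs) = f px r ∷ All-Pointwise f pxs rs

AllPairs-Pointwise : ∀ {A B : Set} {P : A → A → Set} {R : A → B → Set} {P' : B → B → Set} {xs ys} →
  (∀ {x x' y y'} → P x x' → R x y → R x' y' → P' y y') → AllPairs P xs → Pointwise R xs ys → AllPairs P' ys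
AllPairs-Pointwise f []         []       = []
AllPairs-Pointwise f (px ∷ pxs) (r ∷ rs) =
  All-Pointwise (λ p r' → f p r r') px rs ∷ AllPairs-Pointwise f pxs rs

-- The pair made dense first must stay dense through `k` further rounds of shrinking, so its
-- regularity is scaled by the loss of those rounds.
extFactor : ℕ → ℕ → ℕ → ℕ
extFactor L K zero    = 1
extFactor L K (suc k) = shrink L (2 * (K * extFactor L K k)) * extFactor L K k

0<^ : ∀ {x} k → 1 ≤ x → 1 ≤ x ^ k
0<^ {x} k 1≤x = m^n>0 x {{>-nonZero 1≤x}} k

0<shrink : ∀ {L K} → 1 ≤ L → 1 ≤ K → 1 ≤ shrink L K
0<shrink {L} {K} 1≤L 1≤K = 0<^ (suc (L * K)) (*-mono-≤ 1≤L 1≤K)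

0<extFactor : ∀ {L K} k → 1 ≤ L → 1 ≤ K → 1 ≤ extFactor L K k
0<extFactor zero    1≤L 1≤K = ≤-refl
0<extFactor (suc k) 1≤L 1≤K = *-mono-≤ (0<shrink 1≤L (*-mono-≤ {1} {2} (s≤s z≤n) (*-mono-≤ 1≤K (0<extFactor k 1≤L 1≤K)))) (0<extFactor k 1≤L 1≤K)

≤-scaleʳ : ∀ {a} b f x → 1 ≤ f → a ≤ b * x → a ≤ b * (x * f)
≤-scaleʳ b f x 1≤f a≤ = ≤-trans a≤ (*-monoʳ-≤ b (m≤m*n x f {{>-nonZero 1≤f}}))

≤-scaleˡ : ∀ {a} b f x → 1 ≤ f → a ≤ b * x → a ≤ b * (f * x)
≤-scaleˡ b f x 1≤f a≤ = ≤-trans a≤ (*-monoʳ-≤ b (m≤n*m x f {{>-nonZero 1≤f}}))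

≤-self : ∀ a {f} → 1 ≤ f → a ≤ a * f
≤-self a 1≤f = m≤m*n a _ {{>-nonZero 1≤f}}

module Extension {n : ℕ} (G : Graph n) where
  open Density G
  open Embedding G

  Shrinks : ℕ → Sub n → Sub n → Set
  Shrinks F C C' = C' ⊆ C × size C ≤ size C' * F

  Sym-⊆ : ∀ {K A B A' B'} L F → Shrinks F A A' → Shrinks F B B' → Sym (K * F) L A B → Sym K L A' B'
  Sym-⊆ L F (A'⊆A , A≤) (B'⊆B , B≤) (d , d') = Dense-⊆ F A'⊆A B'⊆B A≤ B≤ d , Dense-⊆ F B'⊆B A'⊆A B≤ A≤ d'

  Sym-mono : ∀ {K K' A B} L → K' ≤ K → Sym K L A B → Sym K' L A B
  Sym-mono L K'≤K (d , d') = Dense-mono K'≤K d , Dense-mono K'≤K d'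

  Sees : ℕ → Sub n → Sub n → Set
  Sees L A C = ∀ u → u ∈ A → 2 * size C ≤ L * deg u C

  -- One densification per cluster, each continuing with the smaller `A`. Bounding the length by `k`
  -- makes the loss depend on `k` alone.
  extend : ∀ {K L} k Cs → length Cs ≤ k → 1 ≤ K → 1 ≤ L → ∀ A → 0 < size A →
    All (λ C → 0 < size C × Sees L A C) Cs →
    (∀ A' Cs' → Shrinks (extFactor L K k) A A' → Pointwise (Shrinks (extFactor L K k)) Cs Cs' →
      All (Sym K L A') Cs' → ⊥) → ⊥
  extend {K} {L} k [] _ 1≤K 1≤L A 0<A [] cont =
    cont A [] (⊆-refl , ≤-self (size A) (0<extFactor k 1≤L 1≤K)) [] []
  extend {K} {L} (suc k) (C ∷ Cs) (s≤s len≤k) 1≤K 1≤L A 0<A ((0<C , AC) ∷ sees) cont =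
    densify-sym {K * F} 1≤KF 1≤L A C 0<A 0<C AC λ A₁ C₁ A₁⊆A C₁⊆C A≤ C≤ AC₁ →
      extend k Cs len≤k 1≤K 1≤L A₁ (0<-factor (size A₁) σ 0<A A≤)
        (All.map (λ (0<D , AD) → 0<D , λ u u∈ → AD u (A₁⊆A u u∈)) sees)
        λ A₂ Cs' (A₂⊆A₁ , A₁≤) shr syms →
          cont A₂ (C₁ ∷ Cs')
            (⊆-trans A₂⊆A₁ A₁⊆A , ≤-chain (size A₂) σ F A≤ A₁≤)
            ((C₁⊆C , ≤-scaleʳ (size C₁) F σ 1≤F C≤) ∷ Pointwise.map (λ {_} {D'} (D'⊆D , D≤) → D'⊆D , ≤-scaleˡ (size D') σ F 1≤σ D≤) shr)
            (Sym-⊆ L F (A₂⊆A₁ , A₁≤) (⊆-refl , ≤-self (size C₁) 1≤F) AC₁ ∷ syms)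
    where
    F σ : ℕ
    F = extFactor L K k
    σ = shrink L (2 * (K * F))
    1≤F : 1 ≤ F
    1≤F = 0<extFactor k 1≤L 1≤K
    1≤KF : 1 ≤ K * F
    1≤KF = *-mono-≤ 1≤K 1≤F
    1≤σ : 1 ≤ σ
    1≤σ = 0<shrink 1≤L (*-mono-≤ {1} {2} (s≤s z≤n) 1≤KF)

-- Constants for regularity and relative size.

module Constants (p L : ℕ) where
  -- Computed backwards through `dense-pair`: `baseK` is the demand of `embed`, `baseF` the loss in
  -- `extend`, `baseσ` the loss in the `densify` before it, and `pairK` the regularity needed at the
  -- start.
  baseK baseF baseσ pairK : ℕ → ℕ
  baseK k = (2 + k) * (2 * L) ^ k
  baseF k = extFactor L (baseK k) k
  baseσ k = shrink L (baseK k * baseF k)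
  pairK k = baseK k * (baseσ k * baseF k)

  pairE : ℕ → ℕ → ℕ
  pairE k Γ = suc (Γ * (baseσ k * baseF k) * (2 * L) ^ k * (2 + L * 2 ^ p))

  -- The sum serves both outcomes of `step`: its first term is for a further cluster, its second for
  -- `dense-pair`.
  stepK : ℕ → ℕ → ℕ
  stepK K k = K * extFactor L K k + pairK k

  -- The factor `L` comes from `many-heavy`, the two powers from pigeonholing over near and over far
  -- clusters.
  stepΓ : ℕ → ℕ → ℕ
  stepΓ k Γ = Γ * (L * (2 ^ k * 2 ^ k))

  baseE : ℕ → ℕ → ℕ
  baseE r Γ = suc (Γ * (2 * (2 * L)) ^ r * (2 + 2 * L * 2 ^ p))

  -- The regularity required of k clusters when i more are to be found: it is computed backwards
  -- from the last step, whereas the relative sizes 1 / Γ in needE are computed forwards.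
  needK : ℕ → ℕ → ℕ → ℕ
  needK r zero    k = suc ((2 + r) * (2 * (2 * L)) ^ r)
  needK r (suc i) k = stepK (needK r i (suc k)) k

  needE : ℕ → ℕ → ℕ → ℕ → ℕ
  needE r zero    k Γ = baseE r Γ
  needE r (suc i) k Γ = pairE k (stepΓ k Γ) + needE r i (suc k) (stepΓ k Γ * extFactor L (needK r i (suc k)) k)

  opaque
    -- The search starts from one cluster of relative size `1 / L` and looks for `suc r` more.
    threshold : ℕ → ℕ
    threshold r = needE r (suc r) 1 L

-- Completing the forbidden clique.

module Pairs {n : ℕ} (G : Graph n) {p Q L : ℕ} (L≡ : L ≡ p * Q) (1≤L : 1 ≤ L) (1≤p : 1 ≤ p) (1≤n : 1 ≤ n) where
  open Density G
  open Embedding G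
  open Extension G
  open Constants p L

  -- After densification `(A , z)` has density just above `s' / p`, and `embed` takes one vertex
  -- from each set of `Cs`, `suc s'` from `A` and `p` from `z`.
  dense-pair : ∀ {s' k Γ S} A z Cs → length Cs ≤ k → All (Cluster S Γ) (A ∷ z ∷ Cs) →
    AllPairs (Sym (pairK k) L) (z ∷ Cs) →
    (∀ u → u ∈ A → suc (suc (s' * Q)) * size z ≤ L * deg u z) → All (Sees L A) Cs →
    CliqueRich p (pairE k Γ) → ¬ CliqueFree S (length Cs + (suc s' + p))
  dense-pair {s'} {k} {Γ} {S} A z Cs len≤k ((A⊆S , n≤A) ∷ (z⊆S , n≤z) ∷ cCs) (zCs ∷ pCs) Az sees rich free =
    -- The pair `(A , z)` goes first, with regularity `Ks` that survives the later shrinking of `A`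
    -- in `extend`.
    densify {Ks} {suc (s' * Q)} 1≤Ks 1≤L A z (pos n≤A) (pos n≤z) Az λ A₁ z₁ A₁⊆A z₁⊆z A≤ z≤ d →
    extend {K₀} k Cs len≤k 1≤K₀ 1≤L A₁ (0<-factor (size A₁) σ (pos n≤A) A≤)
      (All.zipWith (λ ((_ , n≤) , AD) → pos n≤ , λ u u∈ → AD u (A₁⊆A u u∈)) (cCs , sees))
    λ A₂ Cs' (A₂⊆A₁ , A₁≤) shr syms →
      let z-shr : Shrinks (σ * F) z z₁
          z-shr = z₁⊆z , ≤-scaleʳ (size z₁) F σ 1≤F z≤
          A₂-shr : Shrinks (σ * F) A A₂
          A₂-shr = ⊆-trans A₂⊆A₁ A₁⊆A , ≤-chain (size A₂) σ F A≤ A₁≤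
          shr' : Pointwise (Shrinks (σ * F)) Cs Cs'
          shr' = Pointwise.map (λ {_} {D'} (D'⊆D , D≤) → D'⊆D , ≤-scaleˡ (size D') σ F 1≤σ D≤) shr
          zCs' : All (Sym K₀ L z₁) Cs'
          zCs' = All-Pointwise (λ zD D-shr → Sym-⊆ L (σ * F) z-shr D-shr zD) zCs shr'
          pCs' : AllPairs (Sym K₀ L) Cs'
          pCs' = AllPairs-Pointwise (λ DE D-shr E-shr → Sym-⊆ L (σ * F) D-shr E-shr DE) pCs shr'
      in embed r Cs' A₂ z₁ (≡.sym (Pointwise-length shr)) L≡ 1≤L 1≤p 1≤n (+-monoʳ-≤ 2 len≤k)
           (cluster-⊆ (A⊆S , n≤A) A₂-shr ∷ cluster-⊆ (z⊆S , n≤z) z-shr ∷ All-Pointwise (λ {_} {D'} c sh → cluster-⊆ c sh) cCs shr')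
           (AllPairs.map (λ (d , _) → Dense-mono Kr≤K₀ d) pCs')
           (All.zipWith (λ ((_ , DA) , (_ , Dz)) → Dense-mono Kr≤K₀ DA , Dense-mono Kr≤K₀ Dz) (syms , zCs'))
           (Dense-mono Kr≤K₀ (Dense-⊆ F A₂⊆A₁ ⊆-refl A₁≤ (≤-self (size z₁) 1≤F) d))
           (CliqueRich-mono (s≤s (*-monoˡ-≤ (2 + L * 2 ^ p) (*-monoʳ-≤ (Γ * (σ * F)) pow≤))) rich) free
    where
    r K₀ F Ks σ : ℕ
    r = length Cs
    K₀ = baseK k
    F = baseF k
    Ks = K₀ * F
    σ = baseσ k
    1≤2L : 1 ≤ 2 * L
    1≤2L = *-mono-≤ {1} {2} (s≤s z≤n) 1≤L
    1≤K₀ : 1 ≤ K₀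
    1≤K₀ = *-mono-≤ {1} {2 + k} (s≤s z≤n) (0<^ k 1≤2L)
    1≤F : 1 ≤ F
    1≤F = 0<extFactor k 1≤L 1≤K₀
    1≤Ks : 1 ≤ Ks
    1≤Ks = *-mono-≤ 1≤K₀ 1≤F
    1≤σ : 1 ≤ σ
    1≤σ = 0<shrink 1≤L 1≤Ks
    pow≤ : (2 * L) ^ r ≤ (2 * L) ^ k
    pow≤ = ^-monoʳ-≤ (2 * L) {{>-nonZero 1≤2L}} len≤k
    Kr≤K₀ : (2 + k) * (2 * L) ^ r ≤ K₀
    Kr≤K₀ = *-monoʳ-≤ (2 + k) pow≤
    pos : ∀ {X} → n ≤ size X * Γ → 0 < size X
    pos {X} n≤ = 0<-factor (size X) Γ 1≤n n≤
    cluster-⊆ : ∀ {X X'} → Cluster S Γ X → Shrinks (σ * F) X X' → Cluster S (Γ * (σ * F)) X'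
    cluster-⊆ {X} {X'} (X⊆S , n≤) (X'⊆X , X≤) = ⊆-trans X'⊆X X⊆S , ≤-chain (size X') Γ (σ * F) n≤ X≤

-- Integer levels of density and heavy vertices.

infixl 7 _div_
-- The value `0` for divisor zero makes `div-lower` unconditional.
_div_ : ℕ → ℕ → ℕ
a div zero  = 0
a div suc b = a / suc b

div-lower : ∀ a b → a div b * b ≤ a
div-lower a zero    = z≤n
div-lower a (suc b) = m/n*n≤m a (suc b)

div-upper : ∀ a b → 0 < b → a ≤ b * suc (a div b)
div-upper a (suc b) _ = begin
  a                                            ≡⟨ m≡m%n+[m/n]*n a (suc b) ⟩
  a % suc b + a / suc b * suc b       ≤⟨ +-monoˡ-≤ _ (<⇒≤ (m%n<n a (suc b))) ⟩
  suc b + a / suc b * suc b                    ≡⟨ *-comm (suc (a / suc b)) (suc b) ⟩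
  suc b * suc (a / suc b)                      ∎
  where open ≤-Reasoning

filterᵇ-empty : ∀ {A : Set} (r : A → Bool) xs → filterᵇ r xs ≡ [] → All (λ x → r x ≡ false) xs
filterᵇ-empty r []       eq = []
filterᵇ-empty r (x ∷ xs) eq with r x in rx
... | false = rx ∷ filterᵇ-empty r xs eq

module Levels {n : ℕ} (G : Graph n) (L : ℕ) where
  open Density G
  open Embedding G

  MinDegree : ℕ → Sub n → Set
  MinDegree c U = ∀ u → u ∈ U → c * size U ≤ L * deg u U

  lev : Fin n → Sub n → ℕ
  lev u C = (L * deg u C) div size C

  lev-lower : ∀ {a} u C → a ≤ lev u C → a * size C ≤ L * deg u C
  lev-lower u C a≤ = ≤-trans (*-monoˡ-≤ (size C) a≤) (div-lower (L * deg u C) (size C))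

  lev≤L : ∀ u C → 0 < size C → lev u C ≤ L
  lev≤L u C 0<C = *-cancelʳ-≤ (lev u C) L (size C) {{>-nonZero 0<C}}
    (≤-trans (lev-lower u C ≤-refl) (*-monoʳ-≤ L (deg≤size u C)))

  total : Fin n → List (Sub n) → ℕ
  total u []       = 0
  total u (C ∷ Cs) = lev u C + total u Cs

  total-≤ : ∀ {T} u Cs → All (λ C → lev u C ≤ T) Cs → total u Cs ≤ length Cs * T
  total-≤ u []       []       = z≤n
  total-≤ u (C ∷ Cs) (h ∷ hs) = +-mono-≤ h (total-≤ u Cs hs)

  total-filter : ∀ {t} u Cs → total u Cs ≤ total u (filterᵇ (λ C → suc t ≤ᵈ lev u C) Cs) + length Cs * t
  total-filter u [] = z≤n
  total-filter {t} u (C ∷ Cs) with suc t ≤ᵈ lev u C in eq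
  ... | true  = ≤-trans (+-monoʳ-≤ (lev u C) (total-filter u Cs)) (≤-trans
        (≤-reflexive (≡.sym (+-assoc (lev u C) _ _))) (+-monoʳ-≤ (lev u C + _) (m≤n+m _ t)))
  ... | false = ≤-trans (+-mono-≤ (≤-pred (≤ᵈ-false eq)) (total-filter u Cs)) (≤-reflexive (swap t (total u (filterᵇ (λ C → suc t ≤ᵈ lev u C) Cs)) (length Cs * t)))
    where
    swap : ∀ t x y → t + (x + y) ≡ x + (t + y)
    swap = solve-∀

  -- The edges between `C` and `U` are counted from both sides. Rounding costs each vertex of `U` at
  -- most one level, whence `suc c` against `c`.
  lev-mass : ∀ {c U C} → C ⊆ U → 0 < size C → MinDegree (suc c) U → c * size U ≤ sumOver U (λ u → lev u C)
  lev-mass {c} {U} {C} C⊆U 0<C δ = +-cancelˡ-≤ (size U) _ _ (*-cancelˡ-≤ (size C) {{>-nonZero 0<C}} (begin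
    size C * (suc c * size U)                        ≡⟨ *-comm (size C) _ ⟩
    suc c * size U * size C                          ≡⟨ sumOver-const (suc c * size U) C ⟨
    sumOver C (λ _ → suc c * size U)                 ≤⟨ sumOver-mono C (λ v v∈C → δ v (C⊆U v v∈C)) ⟩
    sumOver C (λ v → L * deg v U)                    ≡⟨ sumOver-* L C _ ⟩
    L * sumOver C (λ v → deg v U)                    ≡⟨ cong (L *_) (deg-swap C U) ⟩
    L * sumOver U (λ u → deg u C)                    ≡⟨ sumOver-* L U _ ⟨
    sumOver U (λ u → L * deg u C)                    ≤⟨ sumOver-mono U (λ u _ → div-upper (L * deg u C) (size C) 0<C) ⟩
    sumOver U (λ u → size C * suc (lev u C))         ≡⟨ sumOver-* (size C) U _ ⟩
    size C * sumOver U (λ u → 1 + lev u C)           ≡⟨ cong (size C *_) (sumOver-+ U _ _) ⟩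
    size C * (size U + sumOver U (λ u → lev u C))    ∎))
    where open ≤-Reasoning

  total-mass : ∀ {c U} Cs → All (λ C → C ⊆ U × 0 < size C) Cs → MinDegree (suc c) U →
    length Cs * (c * size U) ≤ sumOver U (λ u → total u Cs)
  total-mass []       []               δ = z≤n
  total-mass {c} {U} (C ∷ Cs) ((C⊆U , 0<C) ∷ h) δ = ≤-trans (+-mono-≤ (lev-mass {c} C⊆U 0<C δ) (total-mass {c} Cs h δ))
    (≤-reflexive (≡.sym (sumOver-+ U _ _)))

  heavy : ℕ → List (Sub n) → Sub n
  heavy c Cs u = (length Cs * c) ≤ᵈ total u Cs

  -- One of the two extra units goes to rounding, so the totals average at least `suc c` per
  -- cluster. None exceeds `L` per cluster, so the other unit must come from an `L`-th part of `U`.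
  many-heavy : ∀ {c U} Cs → 1 ≤ length Cs → All (λ C → C ⊆ U × 0 < size C) Cs → MinDegree (2 + c) U →
    size U ≤ size (U ∩ heavy c Cs) * L
  many-heavy {c} {U} Cs 1≤k h δ = *-cancelˡ-≤ k {{>-nonZero 1≤k}} (+-cancelʳ-≤ (k * c * size U) _ _ (begin
    k * size U + k * c * size U                      ≡⟨ regroup k (size U) c ⟩
    k * (suc c * size U)                             ≤⟨ total-mass {suc c} Cs h δ ⟩
    sumOver U tot                                    ≡⟨ sumOver-split U H tot ⟩
    sumOver (U ∩ H) tot + sumOver (U ∖ H) tot        ≤⟨ +-mono-≤
      (sumOver-mono (U ∩ H) λ u _ → total-≤ u Cs (All.map (λ {C} (_ , 0<C) → lev≤L u C 0<C) h))
      (sumOver-mono (U ∖ H) λ u u∈ → <⇒≤ (≤ᵈ-false (∈-∖ʳ U H u u∈))) ⟩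
    sumOver (U ∩ H) (λ _ → k * L) + sumOver (U ∖ H) (λ _ → k * c)  ≡⟨ cong₂ _+_ (sumOver-const (k * L) (U ∩ H)) (sumOver-const (k * c) (U ∖ H)) ⟩
    k * L * size (U ∩ H) + k * c * size (U ∖ H)      ≤⟨ +-monoʳ-≤ _ (*-monoʳ-≤ (k * c) (size-⊆ (∖-⊆ˡ U H))) ⟩
    k * L * size (U ∩ H) + k * c * size U            ≡⟨ cong (_+ k * c * size U) (rotate k L (size (U ∩ H))) ⟩
    k * (size (U ∩ H) * L) + k * c * size U          ∎))
    where
    open ≤-Reasoning
    k : ℕ
    k = length Cs
    H : Sub n
    H = heavy c Cs
    tot : Fin n → ℕ
    tot u = total u Cs
    regroup : ∀ k u c → k * u + k * c * u ≡ k * (suc c * u)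
    regroup = solve-∀
    rotate : ∀ k l a → k * l * a ≡ k * (a * l)
    rotate = solve-∀

-- One more cluster, or a contradiction.

module Growth {n : ℕ} (G : Graph n) {p Q g m L : ℕ} (L≡ : L ≡ p * Q) (1≤L : 1 ≤ L) (1≤p : 1 ≤ p) (1≤n : 1 ≤ n)
  (turán : ∀ j s → j + s ≡ m → j * s * Q ≤ suc j * g) where
  open Density G
  open Embedding G
  open Extension G
  open Levels G L
  open Pairs G {p} {Q} L≡ 1≤L 1≤p 1≤n
  open Constants p L

  Configuration : Sub n → ℕ → ℕ → List (Sub n) → Set
  Configuration U K Γ Cs = All (Cluster U Γ) Cs × AllPairs (Sym K L) Cs

  step : ∀ {K Γ k U} Cs → length Cs ≡ k → 1 ≤ k → k ≤ m → 1 ≤ K → n ≤ size U * Γ →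
    MinDegree (4 + g) U → CliqueFree U (m + p) → Configuration U (stepK K k) Γ Cs →
    CliqueRich p (pairE k (stepΓ k Γ)) →
    (∀ Cs' → length Cs' ≡ suc k → Configuration U K (stepΓ k Γ * extFactor L K k) Cs' → ⊥) → ⊥
  step {K} {Γ} {k} {U} Cs refl 1≤k k≤m 1≤K n≤U δ free (clusters , pairs) rich cont =
    split-on (length js ≟ k)
    where
    A : Sub n
    -- Of the `4` extra units of minimum degree, `many-heavy` spends two. In `none-far` the other
    -- two cover one level for every cluster and one more for every near cluster.
    A = U ∩ heavy (2 + g) Cs
    U≤A : size U ≤ size A * L
    U≤A = many-heavy {2 + g} Cs 1≤k (All.map (λ {C} (C⊆U , n≤C) → C⊆U , 0<-factor (size C) Γ 1≤n n≤C) clusters) δ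
    -- Level `2` is what `densify-sym` requires.
    near : Fin n → Sub n → Bool
    near u C = 2 ≤ᵈ lev u C
    pig₁ : Σ (List (Sub n)) λ ys → Σ (Sub n) λ Y →
      Y ⊆ A × size A ≤ size Y * 2 ^ length Cs × (∀ u → u ∈ Y → filterᵇ (near u) Cs ≡ ys)
    pig₁ = pigeonhole near Cs A
    js : List (Sub n)
    js = proj₁ pig₁
    A₁ : Sub n
    A₁ = proj₁ (proj₂ pig₁)
    A₁⊆A : A₁ ⊆ A
    A₁⊆A = proj₁ (proj₂ (proj₂ pig₁))
    A≤A₁ : size A ≤ size A₁ * 2 ^ k
    A≤A₁ = proj₁ (proj₂ (proj₂ (proj₂ pig₁)))
    js≡ : ∀ u → u ∈ A₁ → filterᵇ (near u) Cs ≡ js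
    js≡ = proj₂ (proj₂ (proj₂ (proj₂ pig₁)))
    n≤A₁ : n ≤ size A₁ * (Γ * (L * 2 ^ k))
    n≤A₁ = ≤-chain (size A₁) Γ (L * 2 ^ k) n≤U (≤-chain (size A₁) L (2 ^ k) U≤A A≤A₁)
    1≤2^k : 1 ≤ 2 ^ k
    1≤2^k = 0<^ k (s≤s z≤n)
    1≤F : 1 ≤ extFactor L K k
    1≤F = 0<extFactor k 1≤L 1≤K
    u₁ : ∃ λ u → u ∈ A₁
    u₁ = member A₁ (0<-factor (size A₁) _ 1≤n n≤A₁)
    js-sees : ∀ {X} → X ⊆ A₁ → All (Sees L X) js
    js-sees X⊆A₁ = All.tabulate λ {C} C∈ u u∈ →
      lev-lower u C (≤ᵈ-true (All.lookup (filterᵇ-holds Cs (js≡ u (X⊆A₁ u u∈))) C∈))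
    cluster-mono : ∀ {f C} → 1 ≤ f → Cluster U Γ C → Cluster U (Γ * f) C
    cluster-mono {f} {C} 1≤f (C⊆U , n≤C) = C⊆U , ≤-scaleʳ (size C) f Γ 1≤f n≤C

    grow : length js ≡ k → ⊥
    grow |js|≡k = extend {K} k Cs ≤-refl 1≤K 1≤L A₁ (0<-factor (size A₁) _ 1≤n n≤A₁)
      (All.zipWith (λ {C} ((_ , n≤C) , sees) → 0<-factor (size C) Γ 1≤n n≤C , sees) (clusters , subst (All (Sees L A₁)) js≡Cs (js-sees ⊆-refl)))
      λ A' Cs' (A'⊆A₁ , A₁≤) shr syms → cont (A' ∷ Cs') (cong suc (≡.sym (Pointwise-length shr)))
        ( (⊆-trans A'⊆A₁ (⊆-trans A₁⊆A (∩-⊆ˡ U (heavy (2 + g) Cs)))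
            , ≤-chain (size A') (stepΓ k Γ) (extFactor L K k) n≤A₁' A₁≤)
          ∷ All-Pointwise (λ {C} {C'} (C⊆U , n≤C) (C'⊆C , C≤) → ⊆-trans C'⊆C C⊆U ,
              ≤-chain (size C') (stepΓ k Γ) (extFactor L K k) (≤-scaleʳ (size C) (L * (2 ^ k * 2 ^ k)) Γ 1≤step n≤C) C≤) clusters shr
        , syms ∷ AllPairs-Pointwise (λ CD C-shr D-shr → Sym-⊆ L (extFactor L K k) C-shr D-shr (Sym-mono L (m≤m+n (K * extFactor L K k) (pairK k)) CD)) pairs shr )
      where
      js≡Cs : js ≡ Cs
      js≡Cs = trans (≡.sym (js≡ _ (proj₂ u₁))) (filter-complete (T? ∘ near (proj₁ u₁)) (trans (cong length (js≡ _ (proj₂ u₁))) |js|≡k))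
      1≤step : 1 ≤ L * (2 ^ k * 2 ^ k)
      1≤step = *-mono-≤ 1≤L (*-mono-≤ 1≤2^k 1≤2^k)
      n≤A₁' : n ≤ size A₁ * stepΓ k Γ
      n≤A₁' = ≤-trans n≤A₁ (*-monoʳ-≤ (size A₁) (*-monoʳ-≤ Γ (*-monoʳ-≤ L (≤-self (2 ^ k) 1≤2^k))))

    close : length js < k → ⊥
    close j<k = by-case zs refl
      where
      j s : ℕ
      j = length js
      s = m ∸ j
      j+s≡m : j + s ≡ m
      j+s≡m = m+[n∸m]≡n (≤-trans (<⇒≤ j<k) k≤m)
      -- In units of `1 / L`, the density `s / p` is `s * Q`. One extra unit is lost in `densify`,
      -- the other keeps the density above `s / p`.
      far : Fin n → Sub n → Bool
      far u C = (2 + s * Q) ≤ᵈ lev u C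
      pig₂ : Σ (List (Sub n)) λ ys → Σ (Sub n) λ Y →
        Y ⊆ A₁ × size A₁ ≤ size Y * 2 ^ length js × (∀ u → u ∈ Y → filterᵇ (far u) js ≡ ys)
      pig₂ = pigeonhole far js A₁
      zs : List (Sub n)
      zs = proj₁ pig₂
      A₂ : Sub n
      A₂ = proj₁ (proj₂ pig₂)
      A₂⊆A₁ : A₂ ⊆ A₁
      A₂⊆A₁ = proj₁ (proj₂ (proj₂ pig₂))
      A₁≤A₂ : size A₁ ≤ size A₂ * 2 ^ k
      A₁≤A₂ = ≤-trans (proj₁ (proj₂ (proj₂ (proj₂ pig₂)))) (*-monoʳ-≤ (size A₂) (^-monoʳ-≤ 2 (<⇒≤ j<k)))
      zs≡ : ∀ u → u ∈ A₂ → filterᵇ (far u) js ≡ zs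
      zs≡ = proj₂ (proj₂ (proj₂ (proj₂ pig₂)))
      n≤A₂ : n ≤ size A₂ * stepΓ k Γ
      n≤A₂ = ≤-chain (size A₂) Γ (L * (2 ^ k * 2 ^ k)) n≤U (≤-trans (≤-chain (size A₂) (L * 2 ^ k) (2 ^ k) (≤-chain (size A₁) L (2 ^ k) U≤A A≤A₁) A₁≤A₂)
        (≤-reflexive (cong (size A₂ *_) (*-assoc L (2 ^ k) (2 ^ k)))))
      u₂ : ∃ λ u → u ∈ A₂
      u₂ = member A₂ (0<-factor (size A₂) _ 1≤n n≤A₂)
      u : Fin n
      u = proj₁ u₂
      -- If no cluster were far above its share, the key inequality would bound the total level of u.
      none-far : zs ≡ [] → ⊥
      none-far zs≡[] = <⇒≱ j<k (+-cancelˡ-≤ (k * g + k) _ _ (begin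
        k * g + k + k                        ≡⟨ regroup k g ⟩
        k * (2 + g)                          ≤⟨ ≤ᵈ-true (∩-⊆ʳ U (heavy (2 + g) Cs) u (A₁⊆A u (A₂⊆A₁ u (proj₂ u₂)))) ⟩
        total u Cs                           ≤⟨ total-filter u Cs ⟩
        total u (filterᵇ (near u) Cs) + k * 1  ≡⟨ cong₂ (λ ys x → total u ys + x) (js≡ u (A₂⊆A₁ u (proj₂ u₂))) (*-identityʳ k) ⟩
        total u js + k                       ≤⟨ +-monoˡ-≤ k (total-≤ u js (All.map (λ f → ≤-pred (≤ᵈ-false f))
                                                  (filterᵇ-empty (far u) js (trans (zs≡ u (proj₂ u₂)) zs≡[])))) ⟩
        j * suc (s * Q) + k                  ≡⟨ regroup' j s Q k ⟩
        j * s * Q + k + j                    ≤⟨ +-monoˡ-≤ j (+-monoˡ-≤ k (≤-trans (turán j s j+s≡m) (*-monoˡ-≤ g j<k))) ⟩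
        k * g + k + j                        ∎))
        where
        open ≤-Reasoning
        regroup : ∀ k g → k * g + k + k ≡ k * (2 + g)
        regroup = solve-∀
        regroup' : ∀ j s q k → j * suc (s * q) + k ≡ j * s * q + k + j
        regroup' = solve-∀
      by-case : ∀ ys → zs ≡ ys → ⊥
      by-case []       zs≡[] = none-far zs≡[]
      by-case (z ∷ zs') zs≡z = found (∈-∃++ z∈js)
        where
        z∈zs : z Mem.∈ filterᵇ (far u) js
        z∈zs = subst (z Mem.∈_) (≡.sym (trans (zs≡ u (proj₂ u₂)) zs≡z)) (here refl)
        z∈js : z Mem.∈ js
        z∈js = proj₁ (∈-filter⁻ (T? ∘ far u) {xs = js} z∈zs)
        z-far : ∀ v → v ∈ A₂ → suc (suc (s * Q)) * size z ≤ L * deg v z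
        z-far v v∈ = lev-lower v z (≤ᵈ-true (All.lookup (filterᵇ-holds js (trans (zs≡ v v∈) zs≡z)) (here refl)))
        found : (∃ λ as → ∃ λ bs → js ≡ as ++ z ∷ bs) → ⊥
        found (as , bs , js≡as++bs) = dense-pair {s' = s} {k = k} A₂ z (as ++ bs) (≤-trans (n≤1+n _) (≤-trans (≤-reflexive (≡.sym j≡)) (<⇒≤ j<k)))
          ((⊆-trans A₂⊆A₁ (⊆-trans A₁⊆A (∩-⊆ˡ U (heavy (2 + g) Cs))) , n≤A₂) ∷
            All.map (cluster-mono (*-mono-≤ 1≤L (*-mono-≤ 1≤2^k 1≤2^k))) (All-resp-↭ perm js-clusters))
          (AllPairs.map (Sym-mono L (m≤n+m (pairK k) (K * extFactor L K k)))
            (Perm.AllPairs-resp-↭ (setoid (Sub n)) (λ (d , d') → d' , d) ((λ {refl d → d}) , (λ {refl d → d})) (↭⇒↭ₛ perm) js-pairs))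
          z-far (All.tail (All-resp-↭ perm (js-sees A₂⊆A₁))) rich
          (subst (CliqueFree U) count≡ free)
          where
          perm : js ↭ z ∷ as ++ bs
          perm = subst (_↭ z ∷ as ++ bs) (≡.sym js≡as++bs) (shift z as bs)
          j≡ : j ≡ suc (length (as ++ bs))
          j≡ = ↭-length perm
          js-clusters : All (Cluster U Γ) js
          js-clusters = subst (All (Cluster U Γ)) (js≡ _ (proj₂ u₁)) (AllP.filter⁺ (T? ∘ near (proj₁ u₁)) clusters)
          js-pairs : AllPairs (Sym (stepK K k) L) js
          js-pairs = subst (AllPairs (Sym (stepK K k) L)) (js≡ _ (proj₂ u₁)) (AllPairsP.filter⁺ (T? ∘ near (proj₁ u₁)) pairs)
          -- As `z` is one of the `j` sets in `js`, the clique has `(j - 1) + (s + 1) + p = m + p`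
          -- vertices.
          count≡ : m + p ≡ length (as ++ bs) + (suc s + p)
          count≡ = trans (cong (_+ p) (trans (≡.sym j+s≡m) (cong (_+ s) j≡))) (regroup (length (as ++ bs)) s p)
            where
            regroup : ∀ x s p → suc x + s + p ≡ x + (suc s + p)
            regroup = solve-∀

    split-on : _ → ⊥
    split-on (yes j≡k) = grow j≡k
    split-on (no j≢k) = close (≤∧≢⇒< (subst (_≤ k) (cong length (js≡ _ (proj₂ u₁))) (length-filter (T? ∘ near (proj₁ u₁)) Cs)) j≢k)

-- Iterating the growth inside a subgraph of large minimum degree.

module Main {n : ℕ} (G : Graph n) {p Q g r L : ℕ} (L≡ : L ≡ p * Q) (1≤L : 1 ≤ L) (1≤p : 1 ≤ p) (1≤n : 1 ≤ n)
  (turán : ∀ j s → j + s ≡ suc r → j * s * Q ≤ suc j * g) where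
  open Density G
  open Embedding G
  open Extension G
  open Levels G L
  open Constants p L
  open Growth G {p} {Q} L≡ 1≤L 1≤p 1≤n turán

  0<needK : ∀ i k → 1 ≤ needK r i k
  0<needK zero    k = s≤s z≤n
  0<needK (suc i) k = ≤-trans (*-mono-≤ (0<needK i (suc k)) (0<extFactor k 1≤L (0<needK i (suc k)))) (m≤m+n _ (pairK k))

  Dense-scale : ∀ {K b L L' A B} → L ≤ L' → Dense K b L A B → Dense K b L' A B
  Dense-scale L≤L' d = dense λ X Y X⊆A Y⊆B A≤ B≤ low → no-low d X Y X⊆A Y⊆B A≤ B≤
    λ u u∈X → ≤-<-trans (*-monoˡ-≤ (deg u Y) L≤L') (low u u∈X)

  -- Each `step` trades one unit of `i` for a further cluster, until there are `2 + r`, one more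
  -- than the forbidden clique permits.
  no-configuration : ∀ i {k Γ U} Cs → length Cs ≡ k → 1 ≤ k → k + i ≡ 2 + r → n ≤ size U * Γ →
    MinDegree (4 + g) U → CliqueFree U (suc r + p) → Configuration U (needK r i k) Γ Cs →
    ¬ CliqueRich p (needE r i k Γ)
  no-configuration zero {k} Cs |Cs| _ k≡ n≤U δ free config rich =
    all-clusters Cs (trans |Cs| (trans (≡.sym (+-identityʳ k)) k≡)) config
    where
    K₀ : ℕ
    K₀ = (2 + r) * (2 * (2 * L)) ^ r
    all-clusters : ∀ Cs → length Cs ≡ 2 + r → Configuration _ (suc K₀) _ Cs → ⊥
    all-clusters (A ∷ B ∷ Ds) |Ds| (clusters , (((AB , _) ∷ ADs) ∷ BDs ∷ pairs)) =
      -- The case `s' = 0`: one vertex from each set except `B`, which gives `p`. Doubling `Q` and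
      -- `L` makes the density `1 / (2 * L)` of `Sym` the one required of `(A , B)`.
      embed {p} {0} {2 * Q} {2 * L} {2 + r} r Ds A B (suc-injective (suc-injective |Ds|)) 2L≡ 1≤2L 1≤p 1≤n ≤-refl
        clusters (AllPairs.map (λ (d , _) → single-edge d) pairs)
        (All.zipWith (λ ((_ , DA) , (_ , DB)) → single-edge DA , single-edge DB) (ADs , BDs))
        (Dense-mono (n≤1+n K₀) AB) rich (subst (CliqueFree _) (≡.sym (+-suc r p)) free)
      where
      1≤2L : 1 ≤ 2 * L
      1≤2L = *-mono-≤ {1} {2} (s≤s z≤n) 1≤L
      2L≡ : 2 * L ≡ p * (2 * Q)
      2L≡ = trans (cong (2 *_) L≡) (swap p Q)
        where
        swap : ∀ p q → 2 * (p * q) ≡ p * (2 * q)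
        swap = solve-∀
      single-edge : ∀ {X Y} → Dense (suc K₀) 1 (2 * L) X Y → Dense K₀ 1 (2 * (2 * L)) X Y
      single-edge d = Dense-scale (m≤m+n (2 * L) (1 * (2 * L))) (Dense-mono (n≤1+n K₀) d)
  no-configuration (suc i) {k} {Γ} {U} Cs |Cs| 1≤k k≡ n≤U δ free config rich =
    step {needK r i (suc k)} Cs |Cs| 1≤k k≤ (0<needK i (suc k)) n≤U δ free config
      (CliqueRich-mono (m≤m+n (pairE k (stepΓ k Γ)) _) rich)
      λ Cs' |Cs'| config' → no-configuration i Cs' |Cs'| (s≤s z≤n) k≡' n≤U' δ free config'
        (CliqueRich-mono (m≤n+m _ (pairE k (stepΓ k Γ))) rich)
    where
    k≡' : suc k + i ≡ 2 + r
    k≡' = trans (≡.sym (+-suc k i)) k≡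
    k≤ : k ≤ suc r
    k≤ = ≤-trans (m≤m+n k i) (≤-reflexive (suc-injective k≡'))
    1≤2^k : 1 ≤ 2 ^ k
    1≤2^k = 0<^ k (s≤s z≤n)
    n≤U' : n ≤ size U * (stepΓ k Γ * extFactor L (needK r i (suc k)) k)
    n≤U' = ≤-scaleʳ (size U) _ (stepΓ k Γ) (0<extFactor k 1≤L (0<needK i (suc k)))
      (≤-scaleʳ (size U) (L * (2 ^ k * 2 ^ k)) Γ (*-mono-≤ 1≤L (*-mono-≤ 1≤2^k 1≤2^k)) n≤U)

  volume : Sub n → ℕ
  volume U = sumOver U λ u → deg u U

  -- `volume` counts ordered pairs, so `u` takes away a row and a column, each of at most `deg u U`.
  remove-vertex : ∀ U u → u ∈ U → size (U ∖ single u) < size U × volume U ≤ volume (U ∖ single u) + 2 * deg u U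
  remove-vertex U u u∈U = smaller , bound
    where
    open ≤-Reasoning
    W : Sub n
    W = U ∖ single u
    single⊆U : single u ⊆ U
    single⊆U v v∈ = subst (_∈ U) (single-≡ u v v∈) u∈U
    parts : ∀ f → sumOver U f ≡ f u + sumOver W f
    parts f = trans (size-split-⊆ single⊆U f) (cong (_+ sumOver W f) (sumOver-single u f))
    smaller : size W < size U
    smaller = ≤-reflexive (≡.sym (parts λ _ → 1))
    bound : volume U ≤ volume W + 2 * deg u U
    bound = begin
      volume U                                    ≡⟨ parts (λ v → deg v U) ⟩
      deg u U + sumOver W (λ v → deg v U)         ≡⟨ cong (deg u U +_) (deg-swap W U) ⟩
      deg u U + sumOver U (λ v → deg v W)         ≡⟨ cong (deg u U +_) (parts (λ v → deg v W)) ⟩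
      deg u U + (deg u W + volume W)              ≤⟨ +-monoʳ-≤ (deg u U) (+-monoˡ-≤ (volume W) (sumOver-⊆ (∖-⊆ˡ U (single u)) _)) ⟩
      deg u U + (deg u U + volume W)              ≡⟨ regroup (deg u U) (volume W) ⟩
      volume W + 2 * deg u U                      ∎
      where
      regroup : ∀ d w → d + (d + w) ≡ w + 2 * d
      regroup = solve-∀

  -- Deleting vertices of too small degree preserves the surplus R in the hypothesis.
  min-degree-subset : ∀ fuel c R U → size U ≤ fuel → c * (size U * suc (size U)) + R ≤ L * volume U →
    ∃ λ W → MinDegree c W × R ≤ L * volume W
  min-degree-subset fuel c R U U≤fuel h with 1 ≤? size (U ∩ low c L U)
  ... | no none = U , (λ u u∈U → ≮⇒≥ λ u-low → none (0<size u u∈U u-low)) , ≤-trans (m≤n+m R _) h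
    where
    0<size : ∀ u → u ∈ U → L * deg u U < c * size U → 1 ≤ size (U ∩ low c L U)
    0<size u u∈U u-low = ≤-trans (≤-reflexive (≡.sym (sumOver-single u λ _ → 1))) (size-⊆ λ v v∈ →
      subst (_∈ U ∩ low c L U) (single-≡ u v v∈) (∈-∩ U (low c L U) u∈U (≤ᵈ-≤ u-low)))
  ... | yes some with fuel | member (U ∩ low c L U) some
  ...   | zero  | u , u∈ = ⊥-elim (<⇒≱ (proj₁ (remove-vertex U u (∩-⊆ˡ U (low c L U) u u∈))) (≤-trans U≤fuel z≤n))
  ...   | suc f | u , u∈ = min-degree-subset f c R W (≤-pred (≤-trans W<U U≤fuel)) (+-cancelʳ-≤ (2 * (c * size U)) _ _ (begin
    c * (size W * suc (size W)) + R + 2 * (c * size U)    ≡⟨ regroup c (size W * suc (size W)) R (size U) ⟩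
    c * (size W * suc (size W) + 2 * size U) + R          ≤⟨ +-monoˡ-≤ R (*-monoʳ-≤ c sizes) ⟩
    c * (size U * suc (size U)) + R                       ≤⟨ h ⟩
    L * volume U                                          ≤⟨ *-monoʳ-≤ L (proj₂ (remove-vertex U u u∈U)) ⟩
    L * (volume W + 2 * deg u U)                          ≡⟨ regroup' L (volume W) (deg u U) ⟩
    L * volume W + 2 * (L * deg u U)                      ≤⟨ +-monoʳ-≤ (L * volume W) (*-monoʳ-≤ 2 (<⇒≤ (≤ᵈ-true (∩-⊆ʳ U (low c L U) u u∈)))) ⟩
    L * volume W + 2 * (c * size U)                       ∎))
    where
    open ≤-Reasoning
    W : Sub n
    W = U ∖ single u
    u∈U : u ∈ U
    u∈U = ∩-⊆ˡ U (low c L U) u u∈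
    W<U : size W < size U
    W<U = proj₁ (remove-vertex U u u∈U)
    -- Multiplied by `c`, this drop of `x * suc x` covers the loss of at most `2 * (c * size U)` in
    -- `L * volume`.
    sizes : size W * suc (size W) + 2 * size U ≤ size U * suc (size U)
    sizes = square (size W) (size U) W<U
      where
      square : ∀ w x → w < x → w * suc w + 2 * x ≤ x * suc x
      square w (suc x) (s≤s w≤x) = ≤-trans (+-monoˡ-≤ (2 * suc x) (*-mono-≤ w≤x (s≤s w≤x))) (≤-reflexive (expand x))
        where
        expand : ∀ x → x * suc x + 2 * suc x ≡ suc x * suc (suc x)
        expand = solve-∀
    regroup : ∀ c w r x → c * w + r + 2 * (c * x) ≡ c * (w + 2 * x) + r
    regroup = solve-∀
    regroup' : ∀ l w d → l * (w + 2 * d) ≡ l * w + 2 * (l * d)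
    regroup' = solve-∀

  opaque
    unfolding threshold

    no-dense-graph : (4 + g) * (n * suc n) + n * n ≤ L * volume full → CliqueFree full (suc r + p) →
      ¬ CliqueRich p (threshold r)
    no-dense-graph h free rich with min-degree-subset n (4 + g) (n * n) full (≤-reflexive (size-full n))
      (subst (λ x → (4 + g) * (x * suc x) + n * n ≤ L * volume full) (≡.sym (size-full n)) h)
    ... | U , δ , nn≤ = no-configuration (suc r) (U ∷ []) refl (s≤s z≤n) refl n≤U δ
          (λ ws |ws| cws _ → free ws |ws| cws (All.universal (λ _ → refl) ws))
          ((⊆-refl , n≤U) ∷ [] , [] ∷ []) rich
      where
      open ≤-Reasoning
      -- The surplus `n * n` forces `U` to be large, because `L * volume U` is at most the square of
      -- `size U * L`.
      n≤U : n ≤ size U * L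
      n≤U = ≮⇒≥ λ U<n → <⇒≱ (*-mono-< U<n U<n) (begin
        n * n                            ≤⟨ nn≤ ⟩
        L * volume U                     ≤⟨ *-monoʳ-≤ L (≤-trans (sumOver-mono U (λ u _ → deg≤size u U)) (≤-reflexive (sumOver-const (size U) U))) ⟩
        L * (size U * size U)            ≤⟨ *-monoʳ-≤ L (*-monoʳ-≤ (size U) (≤-self (size U) 1≤L)) ⟩
        L * (size U * (size U * L))      ≡⟨ rotate L (size U) (size U * L) ⟩
        size U * L * (size U * L)        ∎)
        where
        rotate : ∀ l u x → l * (u * x) ≡ u * l * x
        rotate = solve-∀

-- Localized Turán weight: with κ = j + 1 the difference of the two sides is (t − κ)(s − (κ − 1)t),
-- a product of two factors of equal sign by the hypotheses on s.
turán-weight : ∀ s t → suc t * (suc t ∸ 2) ≤ s → s ≤ suc t * suc t →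
  ∀ j k → j + k ≡ s + t → j * k * suc t ≤ suc j * (s * t)
turán-weight s t lo hi j k j+k≡ with ≤-total j t
... | inj₁ j≤t with m≤n⇒∃[o]m+o≡n j≤t
...   | zero , refl rewrite +-identityʳ j | +-cancelˡ-≡ j k s (trans j+k≡ (+-comm s j)) = ≤-reflexive (same j s)
  where
  same : ∀ j s → j * s * suc j ≡ suc j * (s * j)
  same = solve-∀
-- Here `suc d = t - j`, and `x = s - j * suc t` is nonnegative by `lo`, as `j` is at most `t - 1`.
-- The slack is `suc d * x`.
...   | suc d , refl with m≤n⇒∃[o]m+o≡n (≤-trans (≤-trans (*-monoʳ-≤ (suc (j + suc d)) j≤) (≤-reflexive (cong (suc (j + suc d) *_) ∸≡))) lo)
  where
  ∸≡ : j + d ≡ suc (j + suc d) ∸ 2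
  ∸≡ = ≡.sym (cong (_∸ 1) (+-suc j d))
  j≤ : j ≤ j + d
  j≤ = m≤m+n j d
...     | x , refl = ≤-trans (m≤m+n _ (suc d * x)) (≤-reflexive (trans (cong (λ k → j * k * suc (j + suc d) + suc d * x) k≡) (identity j d x)))
  where
  s' : ℕ
  s' = suc (j + suc d) * j + x
  k≡ : k ≡ suc (j + suc d) * j + x + suc d
  k≡ = +-cancelˡ-≡ j k _ (trans j+k≡ (shuffle s' j (suc d)))
    where
    shuffle : ∀ s j d → s + (j + d) ≡ j + (s + d)
    shuffle = solve-∀
  identity : ∀ j d x → j * (suc (j + suc d) * j + x + suc d) * suc (j + suc d) + suc d * x ≡ suc j * ((suc (j + suc d) * j + x) * (j + suc d))
  identity = solve-∀
turán-weight s t lo hi j k j+k≡ | inj₂ t≤j with m≤n⇒∃[o]m+o≡n t≤j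
... | zero , refl rewrite +-identityʳ t | +-cancelˡ-≡ t k s (trans j+k≡ (+-comm s t)) = ≤-reflexive (same t s)
  where
  same : ∀ j s → j * s * suc j ≡ suc j * (s * j)
  same = solve-∀
-- Now `suc d = j - t`, and `x = j * suc t - s` is nonnegative by `hi`. The slack is again
-- `suc d * x`.
... | suc d , refl with s≡ | m≤n⇒∃[o]m+o≡n (≤-trans hi (*-monoˡ-≤ (suc t) (≤-trans (s≤s (m≤m+n t d)) (≤-reflexive (≡.sym (+-suc t d))))))
  where
  s≡ : s ≡ k + suc d
  s≡ = +-cancelʳ-≡ t s (k + suc d) (trans (≡.sym j+k≡) (shuffle t (suc d) k))
    where
    shuffle : ∀ t d k → t + d + k ≡ k + d + t
    shuffle = solve-∀
...   | refl | x , eq = +-cancelʳ-≤ (suc d * (k + suc d)) _ _ (≤-trans (m≤m+n _ (suc d * x)) (≤-reflexive (begin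
    j * k * suc t + suc d * (k + suc d) + suc d * x      ≡⟨ +-assoc (j * k * suc t) _ _ ⟩
    j * k * suc t + (suc d * (k + suc d) + suc d * x)    ≡⟨ cong (j * k * suc t +_) (*-distribˡ-+ (suc d) (k + suc d) x) ⟨
    j * k * suc t + suc d * (k + suc d + x)              ≡⟨ cong (λ y → j * k * suc t + suc d * y) eq ⟩
    j * k * suc t + suc d * (j * suc t)                  ≡⟨ identity t d k ⟩
    suc j * ((k + suc d) * t) + suc d * (k + suc d)      ∎)))
  where
  open ≡-Reasoning
  identity : ∀ t d k → (t + suc d) * k * suc t + suc d * ((t + suc d) * suc t) ≡ suc (t + suc d) * ((k + suc d) * t) + suc d * (k + suc d)
  identity = solve-∀

-- Edge count, cliques and `α_p` in terms of indicator sets and lists.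

listSum-tabulate : ∀ {n} (f : Fin n → ℕ) → ListAction.sum (tabulate f) ≡ sum f
listSum-tabulate {zero}  f = refl
listSum-tabulate {suc n} f = cong (f zero +_) (listSum-tabulate (f ∘ suc))

listSum-allFin : ∀ {n} (f : Fin n → ℕ) → ListAction.sum (map f (allFin n)) ≡ sum f
listSum-allFin {n} f = trans (cong ListAction.sum (map-tabulate (λ i → i) f)) (listSum-tabulate f)

∣tabulate∣ : ∀ {n} (X : Sub n) → ∣ Vec.tabulate X ∣ ≡ sum (λ u → ind (X u) * 1)
∣tabulate∣ {zero}  X = refl
∣tabulate∣ {suc n} X with X zero
... | true  = cong suc (∣tabulate∣ (X ∘ suc))
... | false = ∣tabulate∣ (X ∘ suc)

opaque
  unfolding sumOver
  ∣tabulate∣≡size : ∀ {n} (X : Sub n) → ∣ Vec.tabulate X ∣ ≡ size X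
  ∣tabulate∣≡size = ∣tabulate∣

module Translation {n : ℕ} (G : Graph n) where
  open Density G
  open Embedding G

  -- `edgeInd` counts a pair in at most one of its two orders, so its matrix plus the transpose
  -- stays below the adjacency matrix.
  2edges≤ : 2 * numEdges G ≤ sumOver full (λ u → deg u full)
  2edges≤ = begin
    2 * numEdges G                                                      ≡⟨ cong (2 *_) edges≡ ⟩
    2 * sum (λ i → sum (e i))                                           ≡⟨ cong (sum (λ i → sum (e i)) +_) (+-identityʳ _) ⟩
    sum (λ i → sum (e i)) + sum (λ i → sum (e i))                       ≡⟨ cong (sum (λ i → sum (e i)) +_) (∑-comm e) ⟩
    sum (λ i → sum (e i)) + sum (λ i → sum (λ j → e j i))               ≡⟨ ∑-distrib-+ (λ i → sum (e i)) _ ⟨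
    sum (λ i → sum (e i) + sum (λ j → e j i))                           ≤⟨ sum-mono (λ i → ≤-trans (≤-reflexive (≡.sym (∑-distrib-+ (e i) _))) (sum-mono (one-order i))) ⟩
    sum (λ i → sum (λ j → ind (N i j)))                                 ≡⟨ sum-cong-≗ (λ i → ≡.sym (sumOver-full (λ j → ind (N i j)))) ⟩
    sum (λ i → deg i full)                                              ≡⟨ sumOver-full (λ i → deg i full) ⟨
    sumOver full (λ u → deg u full)                                     ∎
    where
    open ≤-Reasoning
    e : Fin n → Fin n → ℕ
    e = edgeInd G
    edges≡ : numEdges G ≡ sum (λ i → sum (e i))
    edges≡ = trans (listSum-allFin (λ i → ListAction.sum (map (e i) (allFin n)))) (sum-cong-≗ λ i → listSum-allFin (e i))
    one-order : ∀ i j → e i j + e j i ≤ ind (N i j)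
    one-order i j rewrite sym G j i with toℕ i <ᵇ toℕ j in i<j | toℕ j <ᵇ toℕ i in j<i | N i j
    ... | true  | true  | _     = ⊥-elim (<-asym (<ᵇ⇒< (toℕ i) (toℕ j) (subst T (≡.sym i<j) _)) (<ᵇ⇒< (toℕ j) (toℕ i) (subst T (≡.sym j<i) _)))
    ... | true  | false | true  = ≤-refl
    ... | true  | false | false = z≤n
    ... | false | true  | true  = ≤-refl
    ... | false | true  | false = z≤n
    ... | false | false | _     = z≤n

  adj-lookup : ∀ {ws} → AllPairs Adj ws → ∀ a b → ¬ a ≡ b → Adj (lookup ws a) (lookup ws b)
  adj-lookup (h ∷ hs) zero    zero    a≢b = contradiction refl a≢b
  adj-lookup (h ∷ hs) zero    (suc b) a≢b = All.lookup h (∈-lookup b)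
  adj-lookup (h ∷ hs) (suc a) zero    a≢b = trans (sym G _ _) (All.lookup h (∈-lookup a))
  adj-lookup (h ∷ hs) (suc a) (suc b) a≢b = adj-lookup hs a b (a≢b ∘ cong suc)

  -- A list of pairwise adjacent vertices has no repetition, since a repeated vertex would be a
  -- loop.
  KFree⇒CliqueFree : ∀ {q} → KFree G q → CliqueFree full q
  KFree⇒CliqueFree free ws refl cws _ = free (lookup ws , injective , adj-lookup cws)
    where
    injective : ∀ {a b} → lookup ws a ≡ lookup ws b → a ≡ b
    injective {a} {b} eq with a Fin.≟ b
    ... | yes a≡b = a≡b
    ... | no  a≢b = case trans (≡.sym (irrefl G (lookup ws a))) (trans (cong (adj G (lookup ws a)) eq) (adj-lookup cws a b a≢b)) of λ ()

  αBound⇒CliqueRich : ∀ {p E m} → (∀ a → ℕtoℚ a ℚ.≤ m → a * E ≤ n) → αBound G p m → CliqueRich p E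
  αBound⇒CliqueRich {p} {E} {m} below α X n<XE free = <⇒≱ n<XE
    (subst (λ a → a * E ≤ n) (∣tabulate∣≡size X) (below (∣ Vec.tabulate X ∣) (α (Vec.tabulate X) λ (f , (f-inj , f-adj) , f∈) →
      free (tabulate f) (length-tabulate f) (AllPairsP.tabulate⁺ (λ {a} {b} a≢b → f-adj a b a≢b))
        (AllP.tabulate⁺ λ a → trans (≡.sym (VecP.lookup∘tabulate X (f a))) (VecP.[]=⇒lookup (f∈ a))))))

-- From rational to natural inequalities.

infixl 8 _÷_
-- `mkℚᵘ` stores the denominator minus one. Unnormalised fractions add and multiply without
-- reduction, so the rules below reduce to casts from `ℕ`.
_÷_ : ℕ → ℕ → ℚᵘ
a ÷ b = mkℚᵘ (ℤ.+ a) (pred b)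

÷-* : ∀ a b c d → (a ÷ suc b) ℚᵘ.* (c ÷ suc d) ≡ (a * c) ÷ (suc b * suc d)
÷-* a b c d = cong (λ i → mkℚᵘ i (pred (suc b * suc d))) (≡.sym (ℤP.pos-* a c))

÷-+ : ∀ a b c d → (a ÷ suc b) ℚᵘ.+ (c ÷ suc d) ≡ (a * suc d + c * suc b) ÷ (suc b * suc d)
÷-+ a b c d = cong (λ i → mkℚᵘ i (pred (suc b * suc d)))
  (trans (cong₂ ℤ._+_ (≡.sym (ℤP.pos-* a (suc d))) (≡.sym (ℤP.pos-* c (suc b)))) (≡.sym (ℤP.pos-+ (a * suc d) (c * suc b))))

÷-≤ : ∀ {a b c d} → (a ÷ suc b) ℚᵘ.≤ (c ÷ suc d) → a * suc d ≤ c * suc b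
÷-≤ {a} {b} {c} {d} (ℚᵘ.*≤* h) = ℤP.drop‿+≤+ (subst₂ ℤ._≤_ (≡.sym (ℤP.pos-* a (suc d))) (≡.sym (ℤP.pos-* c (suc b))) h)

÷-< : ∀ {a b c d} → (a ÷ suc b) ℚᵘ.< (c ÷ suc d) → a * suc d < c * suc b
÷-< {a} {b} {c} {d} (ℚᵘ.*<* h) = ℤP.drop‿+<+ (subst₂ ℤ._<_ (≡.sym (ℤP.pos-* a (suc d))) (≡.sym (ℤP.pos-* c (suc b))) h)

toℚᵘ-frac : ∀ a b → toℚᵘ (frac a (suc b)) ≃ a ÷ suc b
toℚᵘ-frac a b = ℚP.toℚᵘ-fromℚᵘ (a ÷ suc b)

toℚᵘ-1-frac : ∀ t → toℚᵘ (1ℚ - frac 1 (suc t)) ≃ t ÷ suc t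
toℚᵘ-1-frac t = begin
  toℚᵘ (1ℚ - frac 1 (suc t))                       ≈⟨ ℚP.toℚᵘ-homo-+ 1ℚ (ℚ.- frac 1 (suc t)) ⟩
  ℚᵘ.1ℚᵘ ℚᵘ.+ toℚᵘ (ℚ.- frac 1 (suc t))            ≈⟨ ℚᵘP.+-congʳ ℚᵘ.1ℚᵘ (ℚP.toℚᵘ-homo‿- (frac 1 (suc t))) ⟩
  ℚᵘ.1ℚᵘ ℚᵘ.- toℚᵘ (frac 1 (suc t))                ≈⟨ ℚᵘP.+-congʳ ℚᵘ.1ℚᵘ (ℚᵘP.-‿cong (toℚᵘ-frac 1 t)) ⟩
  ℚᵘ.1ℚᵘ ℚᵘ.- (1 ÷ suc t)                          ≡⟨ cong₂ (λ a b → mkℚᵘ (ℤ.+ a) b) (+-identityʳ t) (+-identityʳ t) ⟩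
  t ÷ suc t                                        ∎
  where open import Relation.Binary.Reasoning.Setoid ℚᵘP.≃-setoid

below-ε : ∀ e n a → ℕtoℚ a ℚ.≤ frac 1 (suc e) ℚ.* ℕtoℚ n → a * suc e ≤ n
below-ε e n a h = subst₂ _≤_ (cong (a *_) (*-identityʳ (suc e))) (trans (*-identityʳ (1 * n)) (*-identityˡ n))
  (÷-≤ {a} {0} {1 * n} (begin
    a ÷ 1                                        ≃⟨ toℚᵘ-frac a 0 ⟨
    toℚᵘ (ℕtoℚ a)                                ≤⟨ ℚP.toℚᵘ-mono-≤ h ⟩
    toℚᵘ (frac 1 (suc e) ℚ.* ℕtoℚ n)             ≃⟨ ℚP.toℚᵘ-homo-* (frac 1 (suc e)) (ℕtoℚ n) ⟩
    toℚᵘ (frac 1 (suc e)) ℚᵘ.* toℚᵘ (ℕtoℚ n)     ≃⟨ ℚᵘP.*-cong (toℚᵘ-frac 1 e) (toℚᵘ-frac n 0) ⟩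
    (1 ÷ suc e) ℚᵘ.* (n ÷ 1)                     ≡⟨ ÷-* 1 e n 0 ⟩
    (1 * n) ÷ (suc e * 1)                        ∎))
  where open ℚᵘP.≤-Reasoning

-- All terms are brought to the denominator `suc p * suc t * suc b`; the `2` of the binomial
-- coefficient moves to the edges, to be matched with `2edges≤`.
above-density : ∀ s p t a b δ x e → toℚᵘ δ ≡ suc a ÷ suc b →
  (frac s (suc p) ℚ.* (1ℚ - frac 1 (suc t)) ℚ.+ δ) ℚ.* frac x 2 ℚ.< ℕtoℚ e →
  (s * t * suc b + suc a * (suc p * suc t)) * x < 2 * e * (suc p * suc t * suc b)
above-density s p t a b δ x e δ≡ h = subst₂ _<_ (*-identityʳ _) (regroup e (suc p * suc t * suc b)) (÷-< {num} {pred (PT * suc b * 2)} {e} {0} (begin-strict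
  num ÷ (PT * suc b * 2)                                           ≡⟨ ÷-* (s * t * suc b + suc a * PT) (pred (PT * suc b)) x 1 ⟨
  (s * t * suc b + suc a * PT) ÷ (PT * suc b) ℚᵘ.* (x ÷ 2)         ≡⟨ cong (ℚᵘ._* (x ÷ 2)) (÷-+ (s * t) (pred PT) (suc a) b) ⟨
  ((s * t) ÷ PT ℚᵘ.+ suc a ÷ suc b) ℚᵘ.* (x ÷ 2)                   ≡⟨ cong (λ y → ((s * t) ÷ PT ℚᵘ.+ y) ℚᵘ.* (x ÷ 2)) δ≡ ⟨
  ((s * t) ÷ PT ℚᵘ.+ toℚᵘ δ) ℚᵘ.* (x ÷ 2)                          ≡⟨ cong (λ y → (y ℚᵘ.+ toℚᵘ δ) ℚᵘ.* (x ÷ 2)) (÷-* s p t t) ⟨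
  ((s ÷ suc p) ℚᵘ.* (t ÷ suc t) ℚᵘ.+ toℚᵘ δ) ℚᵘ.* (x ÷ 2)          ≃⟨ ℚᵘP.*-cong (ℚᵘP.+-congˡ (toℚᵘ δ) c≃) (toℚᵘ-frac x 1) ⟨
  (toℚᵘ γ ℚᵘ.+ toℚᵘ δ) ℚᵘ.* toℚᵘ (frac x 2)                        ≃⟨ ℚᵘP.*-congʳ (ℚP.toℚᵘ-homo-+ γ δ) ⟨
  toℚᵘ (γ ℚ.+ δ) ℚᵘ.* toℚᵘ (frac x 2)                              ≃⟨ ℚP.toℚᵘ-homo-* (γ ℚ.+ δ) (frac x 2) ⟨
  toℚᵘ ((γ ℚ.+ δ) ℚ.* frac x 2)                                    <⟨ ℚP.toℚᵘ-mono-< h ⟩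
  toℚᵘ (ℕtoℚ e)                                                    ≃⟨ toℚᵘ-frac e 0 ⟩
  e ÷ 1                                                            ∎))
  where
  open ℚᵘP.≤-Reasoning
  PT num : ℕ
  PT = suc p * suc t
  num = (s * t * suc b + suc a * PT) * x
  γ : ℚ
  γ = frac s (suc p) ℚ.* (1ℚ - frac 1 (suc t))
  c≃ : toℚᵘ γ ≃ (s ÷ suc p) ℚᵘ.* (t ÷ suc t)
  c≃ = ℚᵘP.≃-trans (ℚP.toℚᵘ-homo-* (frac s (suc p)) (1ℚ - frac 1 (suc t))) (ℚᵘP.*-cong (toℚᵘ-frac s p) (toℚᵘ-1-frac t))
  regroup : ∀ e d → e * (d * 2) ≡ 2 * e * d
  regroup = solve-∀

-- The surplus 6 n (n − 1) pays for passing from n (n − 1) to n (n + 1), for the 4 in 4 + g and for n * n.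
edge-surplus : ∀ g n → 11 + 2 * g ≤ n → (4 + g) * (n * suc n) + n * n ≤ (g + 6) * (n * (n ∸ 1))
edge-surplus g (suc n) (s≤s N≤n) = begin
  (4 + g) * (suc n * suc (suc n)) + suc n * suc n            ≡⟨ expand g n ⟩
  suc n * ((5 + g) * n + (9 + 2 * g))                        ≤⟨ *-monoʳ-≤ (suc n) (+-monoʳ-≤ ((5 + g) * n) (≤-trans (n≤1+n _) N≤n)) ⟩
  suc n * ((5 + g) * n + n)                                  ≡⟨ collect g n ⟩
  (g + 6) * (suc n * n)                                      ∎
  where
  open ≤-Reasoning
  expand : ∀ g n → (4 + g) * (suc n * suc (suc n)) + suc n * suc n ≡ suc n * ((5 + g) * n + (9 + 2 * g))
  expand = solve-∀
  collect : ∀ g n → suc n * ((5 + g) * n + n) ≡ (g + 6) * (suc n * n)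
  collect = solve-∀

-- Choice of constants and conclusion.

theorem1p5 : (p s t : ℕ) → 1 ≤ p → 1 ≤ s → 1 ≤ t → t * (t ∸ 2) ≤ s → s ≤ t * t → s + t ∸ 1 ≤ p → ϱ≤ p (p + s + t ∸ 1) (frac s p Data.Rational.* (1ℚ - frac 1 t))
theorem1p5 (suc p) (suc s) (suc t) _ _ _ lo hi _ (mkℚ (ℤ.+ suc a) b c) _ =
  frac 1 (suc E) , ℚP.normalize-pos 1 (suc E) , 11 + 2 * g , bound
  where
  M Q L g r E : ℕ
  -- With this `M`, `g / L` is the density in the theorem, and `δ = suc a / suc b` is worth at least
  -- `6` units of `1 / L`, which `edge-surplus` consumes.
  M = 6 * suc b
  Q = suc t * M
  L = suc p * Q
  g = suc s * t * M
  -- After the pattern match `s` and `t` are predecessors, so `suc r` is the `m` of the outline.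
  r = s + t
  E = Constants.threshold (suc p) L r
  1≤L : 1 ≤ L
  1≤L = s≤s z≤n
  turán : ∀ j k → j + k ≡ suc r → j * k * Q ≤ suc j * g
  turán j k j+k≡ = begin
    j * k * (suc t * M)            ≡⟨ *-assoc (j * k) (suc t) M ⟨
    j * k * suc t * M              ≤⟨ *-monoˡ-≤ M (turán-weight (suc s) t lo hi j k j+k≡) ⟩
    suc j * (suc s * t) * M        ≡⟨ *-assoc (suc j) (suc s * t) M ⟩
    suc j * g                      ∎
    where open ≤-Reasoning
  density : ℚ
  density = frac (suc s) (suc p) ℚ.* (1ℚ - frac 1 (suc t)) ℚ.+ mkℚ (ℤ.+ suc a) b c
  bound : ∀ n → 11 + 2 * g ≤ n → (G : Graph n) → KFree G (suc p + suc s + suc t ∸ 1) →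
    αBound G (suc p) (frac 1 (suc E) ℚ.* ℕtoℚ n) →
    ℕtoℚ (numEdges G) ℚ.≤ density ℚ.* frac (n * (n ∸ 1)) 2
  bound n N≤n G free α = decidable-stable (ℕtoℚ (numEdges G) ℚP.≤? density ℚ.* frac (n * (n ∸ 1)) 2) λ e≰ →
    no-dense-graph (dense-enough (ℚP.≰⇒> e≰))
      (KFree⇒CliqueFree (subst (KFree G) (clique-size p s t) free))
      (CliqueRich-mono (n≤1+n E) (αBound⇒CliqueRich (below-ε E n) α))
    where
    open ≤-Reasoning
    open Embedding G using (CliqueRich-mono)
    open Translation G
    open Main G {suc p} {Q} {g} {r} {L} refl 1≤L (s≤s z≤n) (≤-trans (s≤s z≤n) N≤n) turán
    clique-size : ∀ p s t → p + suc s + suc t ≡ suc (s + t) + suc p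
    clique-size = solve-∀
    x e num : ℕ
    x = n * (n ∸ 1)
    e = numEdges G
    num = suc s * t * suc b + suc a * (suc p * suc t)
    dense-enough : density ℚ.* frac x 2 ℚ.< ℕtoℚ e → (4 + g) * (n * suc n) + n * n ≤ L * volume full
    dense-enough e> = begin
      (4 + g) * (n * suc n) + n * n                        ≤⟨ edge-surplus g n N≤n ⟩
      (g + 6) * x                                          ≤⟨ *-monoˡ-≤ x (+-monoʳ-≤ g (≤-self 6 (s≤s z≤n))) ⟩
      (g + 6 * (suc a * (suc p * suc t))) * x              ≡⟨ scale (suc s * t) (suc b) (suc a * (suc p * suc t)) x ⟩
      6 * (num * x)                                        ≤⟨ *-monoʳ-≤ 6 (<⇒≤ (above-density (suc s) p t a b (mkℚ (ℤ.+ suc a) b c) x e refl e>)) ⟩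
      6 * (2 * e * (suc p * suc t * suc b))                ≡⟨ rescale (suc p) (suc t) (suc b) e ⟩
      L * (2 * e)                                          ≤⟨ *-monoʳ-≤ L 2edges≤ ⟩
      L * volume full                                      ∎
      where
      scale : ∀ s b a x → (s * (6 * b) + 6 * a) * x ≡ 6 * ((s * b + a) * x)
      scale = solve-∀
      rescale : ∀ p t b e → 6 * (2 * e * (p * t * b)) ≡ p * (t * (6 * b)) * (2 * e)
      rescale = solve-∀
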